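{- Let $k$ be a finite field with $q$ elements, and let $m,n$ be integers with $0\le m\le (n+1)/2$. Let $\widehat{\chi}_{H_m}:V_n\to\mathbf{C}$ be the discrete Fourier transform of the characteristic function of $H_m\subseteq W_n$. Then for every $P\in V_n$, $$\widehat{\chi}_{H_m}(P)=q^m\left(\omega_m(P)-\omega_{m-1}(P)\right).$$
   Context: For an integer $n\ge -1$, $V_n$ is the $(n+1)$-dimensional $k$-vector space of homogeneous polynomials $P(Y,Z)=\sum_{i=0}^n a_iY^iZ^{n-i}$ of degree $n$ (including $0$) in $k[Y,Z]$, with $V_{ -1}=\{0\}$. $W_n$ is the dual of $V_n$, identified with the space of sequences $x=(x_0,\ldots,x_n)\in k^{n+1}$ via the pairing $\langle P,x\rangle=\sum_{i=0}^n a_ix_i$. For $0\le 2m\le n+1$, $H_m\subseteq W_n$ is the set of sequences $(x_0,\ldots,x_n)$ for which there exist $a_0,\ldots,a_m\in k$, not all zero, such that $\sum_{i=0}^m a_ix_{i+j}=0$ for each $j=0,1,\ldots,n-m$. Its characteristic function $\chi_{H_m}:W_n\to\{0,1\}$ equals $1$ on $H_m$ and $0$ elsewhere. Fix a nontrivial homomorphism $\psi_0$ from the additive group of $k$ to the unit circle in $\mathbf{C}$. The discrete Fourier transform of $F:W_n\to\mathbf{C}$ is $\widehat F:V_n\to\mathbf{C}$, $\widehat F(P)=\sum_{x\in W_n}F(x)\psi_0(\langle P,x\rangle)$. For $P\in V_n$ and an integer $d$, $\omega_d(P)$ is $1/(q-1)$ times the number of nonzero homogeneous polynomials $Q$ of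 degree $d$ in $k[Y,Z]$ such that $P$ is a multiple of $Q$ in $k[Y,Z]$ (so $\omega_d(P)=0$ for $d<0$, and every nonzero $Q$ of degree $d\ge 0$ counts when $P=0$). -}

module Defs where

open import Level using (Level)
open import Algebra.Bundles using (CommutativeRing)
open import Algebra.Bundles.Raw using (RawMagma)
open import Algebra.Structures using (IsCommutativeRing)
import Algebra.Definitions.RawMagma as RawMagmaDefinitions
import Algebra.Properties.CommutativeMonoid.Sum as FiniteSum
open import Data.Bool.Base using (if_then_else_)
open import Data.Empty using (⊥-elim)
open import Data.Fin.Base as Fin using (Fin; toℕ)
import Data.Fin.Properties as Fin
open import Data.Integer.Base as ℤ using (ℤ; +_; -[1+_])
import Data.Integer.Properties as ℤ
import Data.Integer.Solver as ℤ-Solver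
open import Data.List.Base as List using (List)
open import Data.List.Membership.Propositional using (_∈_; lose)
import Data.List.Membership.Propositional.Properties as ∈
import Data.List.Relation.Unary.Any as Any
open import Data.Nat.Base as ℕ using (ℕ; zero; suc)
import Data.Nat.Properties as ℕ
import Data.Nat.Solver as ℕ-Solver
open import Data.Product.Base using (∃; ∃-syntax; _×_; _,_; proj₁; proj₂)
open import Data.Rational.Base as ℚ using (ℚ; 0ℚ; 1ℚ; ½)
import Data.Rational.Properties as ℚ
import Data.Rational.Solver as ℚ-Solver
open import Data.Vec.Base as Vec using (Vec; []; _∷_)
import Data.Vec.Properties as Vec
open import Function.Bundles using (_↔_; Inverse)
open import Relation.Binary.Definitions using (DecidableEquality)
open import Relation.Binary.PropositionalEquality
open import Relation.Nullary.Decidable using (Dec; yes; no; does; map′; _×-dec_; ¬?; dec-true; dec-false)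
open import Relation.Nullary.Negation using (¬_)

-- Real numbers are Cauchy sequences of rationals; two of them are
-- identified when their difference tends to 0.

record ℝ : Set where
  constructor mkℝ
  field
    seq    : ℕ → ℚ
    cauchy : ∀ ε → 0ℚ ℚ.< ε → ∃[ N ] ∀ i j → N ℕ.≤ i → N ℕ.≤ j →
             ℚ.∣ seq i ℚ.- seq j ∣ ℚ.< ε

open ℝ public

infix 4 _≈ʳ_
_≈ʳ_ : ℝ → ℝ → Set
x ≈ʳ y = ∀ ε → 0ℚ ℚ.< ε → ∃[ N ] ∀ i → N ℕ.≤ i → ℚ.∣ seq x i ℚ.- seq y i ∣ ℚ.< ε

halve : ∀ ε → 0ℚ ℚ.< ε → 0ℚ ℚ.< ½ ℚ.* ε
halve ε 0<ε = subst (ℚ._< ½ ℚ.* ε) (ℚ.*-zeroʳ ½) (ℚ.*-monoʳ-<-pos ½ 0<ε)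

halves : ∀ ε → ½ ℚ.* ε ℚ.+ ½ ℚ.* ε ≡ ε
halves ε = trans (sym (ℚ.*-distribʳ-+ ε ½ ½)) (ℚ.*-identityˡ ε)

+-identity : ∀ a b c d → (a ℚ.- c) ℚ.+ (b ℚ.- d) ≡ (a ℚ.+ b) ℚ.- (c ℚ.+ d)
+-identity = solve 4 (λ a b c d → (a :- c) :+ (b :- d) := (a :+ b) :- (c :+ d)) refl
  where open ℚ-Solver.+-*-Solver

*-identity : ∀ a b c d → a ℚ.* (b ℚ.- d) ℚ.+ (a ℚ.- c) ℚ.* d ≡ a ℚ.* b ℚ.- c ℚ.* d
*-identity = solve 4 (λ a b c d → a :* (b :- d) :+ (a :- c) :* d := a :* b :- c :* d) refl
  where open ℚ-Solver.+-*-Solver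

neg-identity : ∀ a b → ℚ.- (a ℚ.- b) ≡ (ℚ.- a) ℚ.- (ℚ.- b)
neg-identity = solve 2 (λ a b → :- (a :- b) := (:- a) :- (:- b)) refl
  where open ℚ-Solver.+-*-Solver

cancel-identity : ∀ a b → (a ℚ.- b) ℚ.+ b ≡ a
cancel-identity = solve 2 (λ a b → (a :- b) :+ b := a) refl
  where open ℚ-Solver.+-*-Solver

factor-identity : ∀ a d e r → a ℚ.* (e ℚ.* r) ℚ.+ (e ℚ.* r) ℚ.* d ≡ e ℚ.* (r ℚ.* (a ℚ.+ d))
factor-identity = solve 4 (λ a d e r → a :* (e :* r) :+ (e :* r) :* d := e :* (r :* (a :+ d))) refl
  where open ℚ-Solver.+-*-Solver

open ℚ.≤-Reasoning

+-estimate : ∀ a b c d ε → ℚ.∣ a ℚ.- c ∣ ℚ.< ½ ℚ.* ε → ℚ.∣ b ℚ.- d ∣ ℚ.< ½ ℚ.* ε →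
  ℚ.∣ (a ℚ.+ b) ℚ.- (c ℚ.+ d) ∣ ℚ.< ε
+-estimate a b c d ε ac bd = begin-strict
  ℚ.∣ (a ℚ.+ b) ℚ.- (c ℚ.+ d) ∣            ≡⟨ cong ℚ.∣_∣ (+-identity a b c d) ⟨
  ℚ.∣ (a ℚ.- c) ℚ.+ (b ℚ.- d) ∣            ≤⟨ ℚ.∣p+q∣≤∣p∣+∣q∣ (a ℚ.- c) (b ℚ.- d) ⟩
  ℚ.∣ a ℚ.- c ∣ ℚ.+ ℚ.∣ b ℚ.- d ∣          <⟨ ℚ.+-mono-< ac bd ⟩
  ½ ℚ.* ε ℚ.+ ½ ℚ.* ε                      ≡⟨ halves ε ⟩
  ε                                        ∎

*-estimate : ∀ a b c d A D δ ε → A ℚ.* δ ℚ.+ δ ℚ.* D ≡ ε → 0ℚ ℚ.< A → 0ℚ ℚ.< D → ℚ.∣ a ∣ ℚ.≤ A → ℚ.∣ d ∣ ℚ.≤ D →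
  ℚ.∣ a ℚ.- c ∣ ℚ.< δ → ℚ.∣ b ℚ.- d ∣ ℚ.< δ →
  ℚ.∣ a ℚ.* b ℚ.- c ℚ.* d ∣ ℚ.< ε
*-estimate a b c d A D δ ε total 0<A 0<D a≤A d≤D ac bd = begin-strict
  ℚ.∣ a ℚ.* b ℚ.- c ℚ.* d ∣
    ≡⟨ cong ℚ.∣_∣ (*-identity a b c d) ⟨
  ℚ.∣ a ℚ.* (b ℚ.- d) ℚ.+ (a ℚ.- c) ℚ.* d ∣
    ≤⟨ ℚ.∣p+q∣≤∣p∣+∣q∣ (a ℚ.* (b ℚ.- d)) ((a ℚ.- c) ℚ.* d) ⟩
  ℚ.∣ a ℚ.* (b ℚ.- d) ∣ ℚ.+ ℚ.∣ (a ℚ.- c) ℚ.* d ∣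
    ≡⟨ cong₂ ℚ._+_ (ℚ.∣p*q∣≡∣p∣*∣q∣ a (b ℚ.- d)) (ℚ.∣p*q∣≡∣p∣*∣q∣ (a ℚ.- c) d) ⟩
  ℚ.∣ a ∣ ℚ.* ℚ.∣ b ℚ.- d ∣ ℚ.+ ℚ.∣ a ℚ.- c ∣ ℚ.* ℚ.∣ d ∣
    ≤⟨ ℚ.+-mono-≤
         (ℚ.*-monoʳ-≤-nonNeg ℚ.∣ b ℚ.- d ∣ {{ℚ.∣-∣-nonNeg (b ℚ.- d)}} a≤A)
         (ℚ.*-monoˡ-≤-nonNeg ℚ.∣ a ℚ.- c ∣ {{ℚ.∣-∣-nonNeg (a ℚ.- c)}} d≤D) ⟩
  A ℚ.* ℚ.∣ b ℚ.- d ∣ ℚ.+ ℚ.∣ a ℚ.- c ∣ ℚ.* D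
    <⟨ ℚ.+-mono-<
         (ℚ.*-monoʳ-<-pos A {{ℚ.positive 0<A}} bd)
         (ℚ.*-monoˡ-<-pos D {{ℚ.positive 0<D}} ac) ⟩
  A ℚ.* δ ℚ.+ δ ℚ.* D
    ≡⟨ total ⟩
  ε ∎

split : ∀ A D ε → 0ℚ ℚ.< A → 0ℚ ℚ.< D → 0ℚ ℚ.< ε →
  ∃[ δ ] 0ℚ ℚ.< δ × A ℚ.* δ ℚ.+ δ ℚ.* D ≡ ε
split A D ε 0<A 0<D 0<ε = go (A ℚ.+ D) refl
  {{ℚ.pos+pos⇒pos A {{ℚ.positive 0<A}} D {{ℚ.positive 0<D}}}}
  where
    go : ∀ M → A ℚ.+ D ≡ M → {{ℚ.Positive M}} → ∃[ δ ] 0ℚ ℚ.< δ × A ℚ.* δ ℚ.+ δ ℚ.* D ≡ ε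
    go M eq {{M-pos}} = ε ℚ.* M⁻¹ ,
      ℚ.positive⁻¹ (ε ℚ.* M⁻¹)
        {{ℚ.pos*pos⇒pos ε {{ℚ.positive 0<ε}} M⁻¹ {{ℚ.1/pos⇒pos M}}}} ,
      (begin-equality
        A ℚ.* (ε ℚ.* M⁻¹) ℚ.+ (ε ℚ.* M⁻¹) ℚ.* D  ≡⟨ factor-identity A D ε M⁻¹ ⟩
        ε ℚ.* (M⁻¹ ℚ.* (A ℚ.+ D))                ≡⟨ cong (λ t → ε ℚ.* (M⁻¹ ℚ.* t)) eq ⟩
        ε ℚ.* (M⁻¹ ℚ.* M)                        ≡⟨ cong (ε ℚ.*_) (ℚ.*-inverseˡ M {{M-nonZero}}) ⟩
        ε ℚ.* 1ℚ                                 ≡⟨ ℚ.*-identityʳ ε ⟩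
        ε                                        ∎)
      where
        M-nonZero : ℚ.NonZero M
        M-nonZero = ℚ.pos⇒nonZero M

        M⁻¹ : ℚ
        M⁻¹ = ℚ.1/_ M {{M-nonZero}}

eventuallyBounded : ∀ x → ∃[ B ] ∃[ N ] 0ℚ ℚ.< B × (∀ i → N ℕ.≤ i → ℚ.∣ seq x i ∣ ℚ.≤ B)
eventuallyBounded x with cauchy x 1ℚ (ℚ.positive⁻¹ 1ℚ)
... | N , close = 1ℚ ℚ.+ ℚ.∣ seq x N ∣ , N ,
  ℚ.+-mono-<-≤ (ℚ.positive⁻¹ 1ℚ) (ℚ.0≤∣p∣ (seq x N)) ,
  λ i N≤i → begin
    ℚ.∣ seq x i ∣
      ≡⟨ cong ℚ.∣_∣ (sym (cancel-identity (seq x i) (seq x N))) ⟩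
    ℚ.∣ (seq x i ℚ.- seq x N) ℚ.+ seq x N ∣
      ≤⟨ ℚ.∣p+q∣≤∣p∣+∣q∣ (seq x i ℚ.- seq x N) (seq x N) ⟩
    ℚ.∣ seq x i ℚ.- seq x N ∣ ℚ.+ ℚ.∣ seq x N ∣
      ≤⟨ ℚ.+-monoˡ-≤ ℚ.∣ seq x N ∣ (ℚ.<⇒≤ (close i N N≤i ℕ.≤-refl)) ⟩
    1ℚ ℚ.+ ℚ.∣ seq x N ∣ ∎

infixl 6 _+ʳ_
_+ʳ_ : ℝ → ℝ → ℝ
seq (x +ʳ y) i = seq x i ℚ.+ seq y i
cauchy (x +ʳ y) ε 0<ε
  with cauchy x (½ ℚ.* ε) (halve ε 0<ε) | cauchy y (½ ℚ.* ε) (halve ε 0<ε)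
... | N , x-close | M , y-close = N ℕ.⊔ M , λ i j N⊔M≤i N⊔M≤j →
  +-estimate (seq x i) (seq y i) (seq x j) (seq y j) ε
    (x-close i j (ℕ.m⊔n≤o⇒m≤o N M N⊔M≤i) (ℕ.m⊔n≤o⇒m≤o N M N⊔M≤j))
    (y-close i j (ℕ.m⊔n≤o⇒n≤o N M N⊔M≤i) (ℕ.m⊔n≤o⇒n≤o N M N⊔M≤j))

infix 8 -ʳ_
-ʳ_ : ℝ → ℝ
seq (-ʳ x) i = ℚ.- seq x i
cauchy (-ʳ x) ε 0<ε with cauchy x ε 0<ε
... | N , close = N , λ i j N≤i N≤j → subst (ℚ._< ε)
  (trans (sym (ℚ.∣-p∣≡∣p∣ (seq x i ℚ.- seq x j)))
    (cong ℚ.∣_∣ (neg-identity (seq x i) (seq x j))))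
  (close i j N≤i N≤j)

infixl 7 _*ʳ_
_*ʳ_ : ℝ → ℝ → ℝ
seq (x *ʳ y) i = seq x i ℚ.* seq y i
cauchy (x *ʳ y) ε 0<ε =
  let A , N₁ , 0<A , x≤A = eventuallyBounded x
      D , N₂ , 0<D , y≤D = eventuallyBounded y
      δ , 0<δ , total    = split A D ε 0<A 0<D 0<ε
      N₃ , x-close       = cauchy x δ 0<δ
      N₄ , y-close       = cauchy y δ 0<δ
  in (N₁ ℕ.⊔ N₂) ℕ.⊔ (N₃ ℕ.⊔ N₄) , λ i j hi hj →
    let hi₁ = ℕ.m⊔n≤o⇒m≤o (N₁ ℕ.⊔ N₂) (N₃ ℕ.⊔ N₄) hi
        hi₂ = ℕ.m⊔n≤o⇒n≤o (N₁ ℕ.⊔ N₂) (N₃ ℕ.⊔ N₄) hi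
        hj₁ = ℕ.m⊔n≤o⇒m≤o (N₁ ℕ.⊔ N₂) (N₃ ℕ.⊔ N₄) hj
        hj₂ = ℕ.m⊔n≤o⇒n≤o (N₁ ℕ.⊔ N₂) (N₃ ℕ.⊔ N₄) hj
    in *-estimate (seq x i) (seq y i) (seq x j) (seq y j) A D δ ε total 0<A 0<D
      (x≤A i (ℕ.m⊔n≤o⇒m≤o N₁ N₂ hi₁))
      (y≤D j (ℕ.m⊔n≤o⇒n≤o N₁ N₂ hj₁))
      (x-close i j (ℕ.m⊔n≤o⇒m≤o N₃ N₄ hi₂) (ℕ.m⊔n≤o⇒m≤o N₃ N₄ hj₂))
      (y-close i j (ℕ.m⊔n≤o⇒n≤o N₃ N₄ hi₂) (ℕ.m⊔n≤o⇒n≤o N₃ N₄ hj₂))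

ℚ⇒ℝ : ℚ → ℝ
seq (ℚ⇒ℝ r) _ = r
cauchy (ℚ⇒ℝ r) ε 0<ε = 0 , λ _ _ _ _ → subst (λ t → ℚ.∣ t ∣ ℚ.< ε) (sym (ℚ.+-inverseʳ r)) 0<ε

record ℂ : Set where
  constructor _+i_
  field
    re im : ℝ

open ℂ public

infix 4 _≈ᶜ_
_≈ᶜ_ : ℂ → ℂ → Set
z ≈ᶜ w = (re z ≈ʳ re w) × (im z ≈ʳ im w)

infixl 6 _+ᶜ_
_+ᶜ_ : ℂ → ℂ → ℂ
z +ᶜ w = (re z +ʳ re w) +i (im z +ʳ im w)

infixl 7 _*ᶜ_
_*ᶜ_ : ℂ → ℂ → ℂ
z *ᶜ w = (re z *ʳ re w +ʳ -ʳ (im z *ʳ im w)) +i (re z *ʳ im w +ʳ im z *ʳ re w)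

ℚ⇒ℂ : ℚ → ℂ
ℚ⇒ℂ r = ℚ⇒ℝ r +i ℚ⇒ℝ 0ℚ

0ᶜ 1ᶜ : ℂ
0ᶜ = ℚ⇒ℂ 0ℚ
1ᶜ = ℚ⇒ℂ 1ℚ

sumᶜ : List ℂ → ℂ
sumᶜ = List.foldr _+ᶜ_ 0ᶜ

OnUnitCircle : ℂ → Set
OnUnitCircle z = re z *ʳ re z +ʳ im z *ʳ im z ≈ʳ ℚ⇒ℝ 1ℚ

record FiniteField (c : Level) : Set (Level.suc c) where
  infixl 7 _*_
  infixl 6 _+_
  infix  8 -_
  field
    Carrier           : Set c
    _+_ _*_           : Carrier → Carrier → Carrier
    -_                : Carrier → Carrier
    0# 1#             : Carrier
    isCommutativeRing : IsCommutativeRing _≡_ _+_ _*_ -_ 0# 1#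
    0≢1               : 0# ≢ 1#
    inverse           : ∀ x → x ≢ 0# → ∃[ y ] x * y ≡ 1#
    q                 : ℕ
    enumeration       : Carrier ↔ Fin q

  commutativeRing : CommutativeRing c c
  commutativeRing = record { isCommutativeRing = isCommutativeRing }

  open CommutativeRing commutativeRing public
    using (zeroˡ; zeroʳ; +-commutativeMonoid)

  open FiniteSum +-commutativeMonoid public
    using (sum-syntax; sum-cong-≗; sum-replicate-zero)

  open Inverse enumeration using () renaming (to to index; from to element)

  element-index : ∀ x → element (index x) ≡ x
  element-index = Inverse.strictlyInverseʳ enumeration

  index-injective : ∀ {x y} → index x ≡ index y → x ≡ y
  index-injective {x} {y} eq =
    trans (sym (element-index x)) (trans (cong element eq) (element-index y))

  infix 4 _≟_
  _≟_ : DecidableEquality Carrier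
  x ≟ y = map′ index-injective (cong index) (index x Fin.≟ index y)

  elements : List Carrier
  elements = List.map element (List.allFin q)

  ∈-elements : ∀ x → x ∈ elements
  ∈-elements x = subst (_∈ elements) (element-index x) (∈.∈-map⁺ element (∈.∈-allFin (index x)))

  q-1-nonZero : ℕ.NonZero (q ℕ.∸ 1)
  q-1-nonZero = go q index index-injective
    where
      singleton : (x y : Fin 1) → x ≡ y
      singleton Fin.zero Fin.zero = refl

      go : ∀ N (f : Carrier → Fin N) → (∀ {x y} → f x ≡ f y → x ≡ y) → ℕ.NonZero (N ℕ.∸ 1)
      go zero          f inj with () ← f 0#
      go (suc zero)    f inj = ⊥-elim (0≢1 (inj (singleton (f 0#) (f 1#))))
      go (suc (suc N)) f inj = _

  record AdditiveCharacter : Set c where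
    field
      ψ            : Carrier → ℂ
      onUnitCircle : ∀ a → OnUnitCircle (ψ a)
      homo         : ∀ a b → ψ (a + b) ≈ᶜ ψ a *ᶜ ψ b

    Nontrivial : Set c
    Nontrivial = ∃[ a ] ¬ (ψ a ≈ᶜ 1ᶜ)

-- The number of integers i with 0 ≤ i ≤ n, for any integer n; thus
-- Fin (count n) is the index set {0, …, n}, empty when n is negative.

count : ℤ → ℕ
count (+ n)    = suc n
count -[1+ _ ] = 0

module _ {c : Level} (k : FiniteField c) where

  open FiniteField k

  -- Elements of k[Y,Z]; coeff i j is the coefficient of Yⁱ Zʲ.

  record Poly : Set c where
    field
      coeff    : ℕ → ℕ → Carrier
      bound    : ℕ
      vanishes : ∀ i j → bound ℕ.≤ i ℕ.+ j → coeff i j ≡ 0#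

  open Poly

  infix 4 _≈ᵖ_
  _≈ᵖ_ : Poly → Poly → Set c
  f ≈ᵖ g = ∀ i j → coeff f i j ≡ coeff g i j

  sum-zero : ∀ {n} (t : Fin n → Carrier) → (∀ a → t a ≡ 0#) → ∑[ a < n ] t a ≡ 0#
  sum-zero {n} t t≡0 = trans (sum-cong-≗ t≡0) (sum-replicate-zero n)

  toℕ≤ : ∀ {i} (a : Fin (suc i)) → toℕ a ℕ.≤ i
  toℕ≤ a = ℕ.s≤s⁻¹ (Fin.toℕ<n a)

  complement : ∀ {i j a b} → a ℕ.≤ i → b ℕ.≤ j →
    (a ℕ.+ b) ℕ.+ ((i ℕ.∸ a) ℕ.+ (j ℕ.∸ b)) ≡ i ℕ.+ j
  complement {i} {j} {a} {b} a≤i b≤j = trans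
    (solve 4 (λ a b x y → (a :+ b) :+ (x :+ y) := (a :+ x) :+ (b :+ y)) refl
      a b (i ℕ.∸ a) (j ℕ.∸ b))
    (cong₂ ℕ._+_ (ℕ.m+[n∸m]≡n a≤i) (ℕ.m+[n∸m]≡n b≤j))
    where open ℕ-Solver.+-*-Solver

  infixl 7 _*ᵖ_
  _*ᵖ_ : Poly → Poly → Poly
  coeff (f *ᵖ g) i j =
    ∑[ a < suc i ] ∑[ b < suc j ]
      (coeff f (toℕ a) (toℕ b) * coeff g (i ℕ.∸ toℕ a) (j ℕ.∸ toℕ b))
  bound (f *ᵖ g) = bound f ℕ.+ bound g
  vanishes (f *ᵖ g) i j N≤i+j = sum-zero _ λ a → sum-zero _ λ b → term a b
    where
      term : ∀ (a : Fin (suc i)) (b : Fin (suc j)) →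
        coeff f (toℕ a) (toℕ b) * coeff g (i ℕ.∸ toℕ a) (j ℕ.∸ toℕ b) ≡ 0#
      term a b with bound f ℕ.≤? toℕ a ℕ.+ toℕ b
      ... | yes large = trans (cong (_* _) (vanishes f _ _ large)) (zeroˡ _)
      ... | no  small = trans (cong (_ *_) (vanishes g _ _ rest)) (zeroʳ _)
        where
          rest : bound g ℕ.≤ (i ℕ.∸ toℕ a) ℕ.+ (j ℕ.∸ toℕ b)
          rest = ℕ.+-cancelˡ-≤ (toℕ a ℕ.+ toℕ b) _ _
            (ℕ.≤-trans (ℕ.+-monoˡ-≤ (bound g) (ℕ.<⇒≤ (ℕ.≰⇒> small)))
              (ℕ.≤-trans N≤i+j (ℕ.≤-reflexive (sym (complement (toℕ≤ a) (toℕ≤ b))))))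

  *ᵖ-rawMagma : RawMagma c c
  *ᵖ-rawMagma = record { Carrier = Poly ; _≈_ = _≈ᵖ_ ; _∙_ = _*ᵖ_ }

  open RawMagmaDefinitions *ᵖ-rawMagma using (_∣_; _,_)

  _≈ᵖ?_ : ∀ f g → Dec (f ≈ᵖ g)
  f ≈ᵖ? g = map′ extend restrict
    (Fin.all? λ i → Fin.all? λ j → coeff f (toℕ i) (toℕ j) ≟ coeff g (toℕ i) (toℕ j))
    where
      N : ℕ
      N = bound f ℕ.⊔ bound g

      agree : ∀ i j → N ℕ.≤ i ℕ.+ j → coeff f i j ≡ coeff g i j
      agree i j large = trans (vanishes f i j (ℕ.m⊔n≤o⇒m≤o (bound f) (bound g) large))
        (sym (vanishes g i j (ℕ.m⊔n≤o⇒n≤o (bound f) (bound g) large)))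

      extend : (∀ (i j : Fin N) → coeff f (toℕ i) (toℕ j) ≡ coeff g (toℕ i) (toℕ j)) → f ≈ᵖ g
      extend eq i j with i ℕ.<? N | j ℕ.<? N
      ... | no i≮N  | _       = agree i j (ℕ.≤-trans (ℕ.≮⇒≥ i≮N) (ℕ.m≤m+n i j))
      ... | yes _   | no j≮N  = agree i j (ℕ.≤-trans (ℕ.≮⇒≥ j≮N) (ℕ.m≤n+m j i))
      ... | yes i<N | yes j<N = subst₂ (λ a b → coeff f a b ≡ coeff g a b)
        (Fin.toℕ-fromℕ< i<N) (Fin.toℕ-fromℕ< j<N) (eq (Fin.fromℕ< i<N) (Fin.fromℕ< j<N))

      restrict : f ≈ᵖ g → ∀ (i j : Fin N) → coeff f (toℕ i) (toℕ j) ≡ coeff g (toℕ i) (toℕ j)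
      restrict eq i j = eq (toℕ i) (toℕ j)

  -- The vector (a₀, …, aₙ) is the homogeneous polynomial Σᵢ aᵢ Yⁱ Zⁿ⁻ⁱ.

  V : ℤ → Set c
  V n = Vec Carrier (count n)

  W : ℤ → Set c
  W n = Vec Carrier (count n)

  IsZero : ∀ {N} → Vec Carrier N → Set c
  IsZero {N} v = v ≡ Vec.replicate N 0#

  -- The default value 0 beyond the end is a convenience: toPoly reads only
  -- entries i ≤ n, and H only entries i + j with i ≤ m and j ≤ n - m.

  infixl 9 _‼_
  _‼_ : ∀ {N} → Vec Carrier N → ℕ → Carrier
  []       ‼ _     = 0#
  (x ∷ _)  ‼ zero  = x
  (_ ∷ xs) ‼ suc i = xs ‼ i

  beyond-count : ∀ {n t} → + t ≡ n → ¬ (count n ℕ.≤ t)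
  beyond-count refl = ℕ.<-irrefl refl

  toPoly : (n : ℤ) → V n → Poly
  coeff (toPoly n v) i j = if does (+ (i ℕ.+ j) ℤ.≟ n) then v ‼ i else 0#
  bound (toPoly n v) = count n
  vanishes (toPoly n v) i j large with + (i ℕ.+ j) ℤ.≟ n
  ... | yes i+j≡n = ⊥-elim (beyond-count i+j≡n large)
  ... | no  _     = refl

  ⟨_,_⟩ : ∀ {n} → V n → W n → Carrier
  ⟨_,_⟩ {n} P x = ∑[ i < count n ] (Vec.lookup P i * Vec.lookup x i)

  -- Lists every vector exactly once, as `enumeration` is a bijection.

  vectors : ∀ N → List (Vec Carrier N)
  vectors zero    = List.[ [] ]
  vectors (suc N) = List.cartesianProductWith _∷_ elements (vectors N)

  ∈-vectors : ∀ {N} (v : Vec Carrier N) → v ∈ vectors N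
  ∈-vectors []       = Any.here refl
  ∈-vectors (x ∷ xs) = ∈.∈-cartesianProductWith⁺ _∷_ (∈-elements x) (∈-vectors xs)

  isZero? : ∀ {N} (v : Vec Carrier N) → Dec (IsZero v)
  isZero? v = Vec.≡-dec _≟_ v _

  any-vector? : ∀ {p N} {S : Vec Carrier N → Set p} → (∀ v → Dec (S v)) → Dec (∃ S)
  any-vector? {N = N} S? = map′ Any.satisfied (λ (v , Sv) → lose (∈-vectors v) Sv)
    (Any.any? S? (vectors N))

  H : (m : ℕ) (n : ℤ) → W n → Set c
  H m n x = ∃[ a ] ¬ IsZero a × ∀ (j : Fin (count (n ℤ.- + m))) →
    ∑[ i < suc m ] (Vec.lookup a i * x ‼ (toℕ i ℕ.+ toℕ j)) ≡ 0#

  H? : ∀ m n x → Dec (H m n x)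
  H? m n x = any-vector? λ a → ¬? (isZero? a) ×-dec Fin.all? λ j → _ ≟ 0#

  χ-H : (m : ℕ) (n : ℤ) → W n → ℂ
  χ-H m n x = if does (H? m n x) then 1ᶜ else 0ᶜ

  fourier : AdditiveCharacter → (n : ℤ) → (W n → ℂ) → V n → ℂ
  fourier ψ₀ n F P = sumᶜ (List.map (λ x → F x *ᶜ ψ ⟨ P , x ⟩) (vectors (count n)))
    where open AdditiveCharacter ψ₀

  -- The quotient ranges over all of k[Y,Z], not only over homogeneous
  -- polynomials.

  Divides : (d n : ℤ) → V d → V n → Set c
  Divides d n Q P = toPoly d Q ∣ toPoly n P

  tabulate-‼ : ∀ {N} (f : ℕ → Carrier) {i} → i ℕ.< N → Vec.tabulate {n = N} (λ t → f (toℕ t)) ‼ i ≡ f i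
  tabulate-‼ {suc N} f {zero}  _         = refl
  tabulate-‼ {suc N} f {suc i} (ℕ.s≤s lt) = tabulate-‼ (λ t → f (suc t)) lt

  component : (e : ℤ) → Poly → V e
  component e f = Vec.tabulate λ i → coeff f (toℕ i) (ℤ.∣ e ∣ ℕ.∸ toℕ i)

  component-≡ : ∀ f {e} i j → + (i ℕ.+ j) ≡ e → coeff (toPoly e (component e f)) i j ≡ coeff f i j
  component-≡ f i j refl rewrite dec-true (+ (i ℕ.+ j) ℤ.≟ + (i ℕ.+ j)) refl =
    trans (tabulate-‼ (λ t → coeff f t (i ℕ.+ j ℕ.∸ t)) (ℕ.s≤s (ℕ.m≤m+n i j)))
      (cong (coeff f i) (ℕ.m+n∸m≡n i j))

  toPoly-≢ : ∀ {n} (v : V n) i j → + (i ℕ.+ j) ≢ n → coeff (toPoly n v) i j ≡ 0#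
  toPoly-≢ {n} v i j ne rewrite dec-false (+ (i ℕ.+ j) ℤ.≟ n) ne = refl

  degree-sum : ∀ {s t u : ℕ} {d n : ℤ} → s ℕ.+ t ≡ u → + t ≡ d → (+ u ≡ n → + s ≡ n ℤ.- d) × (+ s ≡ n ℤ.- d → + u ≡ n)
  degree-sum {s} {t} {d = d} {n} refl refl =
    (λ { refl → solve 2 (λ s t → s := (s :+ t) :- t) refl (+ s) (+ t) }) ,
    (λ eq → trans (cong (ℤ._+ + t) eq) (solve 2 (λ n t → (n :- t) :+ t := n) refl n (+ t)))
    where open ℤ-Solver.+-*-Solver

  -- A quotient may be replaced by its component of degree n - d, which
  -- makes divisibility decidable by finite search.

  homogenise : ∀ d n (Q : V d) (P : V n) (R : Poly) → R *ᵖ toPoly d Q ≈ᵖ toPoly n P →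
    toPoly (n ℤ.- d) (component (n ℤ.- d) R) *ᵖ toPoly d Q ≈ᵖ toPoly n P
  homogenise d n Q P R eq i j = by-degree (+ (i ℕ.+ j) ℤ.≟ n)
    where
      S : Poly
      S = toPoly (n ℤ.- d) (component (n ℤ.- d) R)

      term : Poly → Fin (suc i) → Fin (suc j) → Carrier
      term f a b = coeff f (toℕ a) (toℕ b) * coeff (toPoly d Q) (i ℕ.∸ toℕ a) (j ℕ.∸ toℕ b)

      same : + (i ℕ.+ j) ≡ n → ∀ a b → term S a b ≡ term R a b
      same i+j≡n a b with + ((i ℕ.∸ toℕ a) ℕ.+ (j ℕ.∸ toℕ b)) ℤ.≟ d
      ... | yes u≡d = cong (_* _) (component-≡ R (toℕ a) (toℕ b)
        (proj₁ (degree-sum (complement (toℕ≤ a) (toℕ≤ b)) u≡d) i+j≡n))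
      ... | no _ = trans (zeroʳ _) (sym (zeroʳ _))

      none : + (i ℕ.+ j) ≢ n → ∀ a b → term S a b ≡ 0#
      none i+j≢n a b with + ((i ℕ.∸ toℕ a) ℕ.+ (j ℕ.∸ toℕ b)) ℤ.≟ d
      ... | yes u≡d = trans (cong (_* _) (toPoly-≢ (component (n ℤ.- d) R) (toℕ a) (toℕ b)
        λ v≡n-d → i+j≢n (proj₂ (degree-sum (complement (toℕ≤ a) (toℕ≤ b)) u≡d) v≡n-d)))
        (zeroˡ _)
      ... | no _ = zeroʳ _

      by-degree : Dec (+ (i ℕ.+ j) ≡ n) → coeff (S *ᵖ toPoly d Q) i j ≡ coeff (toPoly n P) i j
      by-degree (yes i+j≡n) = trans
        (sum-cong-≗ λ a → sum-cong-≗ λ b → same i+j≡n a b) (eq i j)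
      by-degree (no i+j≢n) = trans
        (sum-zero (λ a → ∑[ b < suc j ] term S a b) λ a → sum-zero (term S a) λ b → none i+j≢n a b)
        (sym (toPoly-≢ P i j i+j≢n))

  divides? : ∀ d n Q P → Dec (Divides d n Q P)
  divides? d n Q P = map′
    (λ (S , eq) → toPoly (n ℤ.- d) S , eq)
    (λ { (R , eq) → component (n ℤ.- d) R , homogenise d n Q P R eq })
    (any-vector? λ S → (toPoly (n ℤ.- d) S *ᵖ toPoly d Q) ≈ᵖ? toPoly n P)

  nonzeroDivisor? : ∀ d n P (Q : V d) → Dec (¬ IsZero Q × Divides d n Q P)
  nonzeroDivisor? d n P Q = ¬? (isZero? Q) ×-dec divides? d n Q P

  ω : (d n : ℤ) → V n → ℚ
  ω d n P = + List.length (List.filter (nonzeroDivisor? d n P) (vectors (count d))) ℚ./ (q ℕ.∸ 1)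
    where instance _ = q-1-nonZero

{-# OPTIONS --safe #-}
module Submission where

-- For x ∈ W_n let A_d(x) be the space of forms Q of degree d whose coefficients
-- solve the Hankel system of x, that is ⟨S Q, x⟩ = 0 for all S ∈ V_{n-d}.
-- If A_m(x) ≠ 0 and 2m ≤ n + 1, then |A_m(x)| = q |A_{m-1}(x)|.  For ≥, a
-- nonzero A_m contains a form M outside Y A_{m-1}, and (t, B) ↦ t M + Y B is
-- injective; M is found by multiplying with Z, because Y E, Z E ∈ A_d imply
-- E ∈ A_{d-1}.  The same bound in degree n + 1 - m gives ≤, because the Hankel
-- matrices of degrees d and n - d are transposes of each other.  Hence
--   (q - 1) χ_{H_m}(x) = (|A_m(x)| - 1) - q (|A_{m-1}(x)| - 1).
-- Writing the conditions on Q as a sum of ψ₀⟨S Q, x⟩ over S and summing over x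
-- first, the transform of |A_d| - 1 at P is q^d times the number of nonzero
-- Q of degree d that divide P.

open import Defs
open import Level using (Level; 0ℓ)
open import Algebra.Bundles using (CommutativeRing)
import Algebra.Definitions.RawMagma as RawMagmaDefinitions
import Algebra.Properties.Ring as RingProperties
import Algebra.Properties.Semiring.Mult as Multiples
import Algebra.Solver.Ring.NaturalCoefficients.Default as SemiringSolver
open import Data.Bool.Base using (if_then_else_)
open import Data.Empty using (⊥-elim)
open import Data.Fin.Base as Fin using (Fin; toℕ)
import Data.Fin.Properties as Fin
import Data.Integer.Properties as ℤ
import Data.Integer.Solver as ℤ-Solver
open import Data.List.Base as List using (List; []; _∷_)
open import Data.List.Membership.Propositional using (_∈_)
import Data.List.Membership.Propositional.Properties as ∈
open import Data.List.Membership.Propositional.Properties.WithK using (unique∧set⇒bag)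
import Data.List.Membership.Setoid.Properties as ∈ₛ
import Data.List.Properties as List
open import Data.List.Relation.Binary.BagAndSetEquality using (∼bag⇒↭)
open import Data.List.Relation.Binary.Permutation.Propositional using (_↭_; ↭⇒↭ₛ′)
import Data.List.Relation.Binary.Permutation.Propositional.Properties as ↭
import Data.List.Relation.Binary.Permutation.Setoid.Properties as ↭ₛ
import Data.List.Relation.Unary.All as All
open import Data.List.Relation.Unary.AllPairs using ([]; _∷_)
import Data.List.Relation.Unary.Any as Any
open import Data.List.Relation.Unary.Unique.Propositional using (Unique)
import Data.List.Relation.Unary.Unique.Propositional.Properties as Unique
open import Data.Nat.Base as ℕ using (ℕ; zero; suc; z≤n; s≤s)
import Data.Nat.Properties as ℕ
open import Data.Product.Base using (∃; ∃-syntax; _×_; _,_; proj₁; proj₂)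
open import Data.Rational.Base as ℚ using (ℚ; 0ℚ; 1ℚ; ½)
import Data.Rational.Properties as ℚ
import Data.Rational.Solver as ℚ-Solver
import Data.Rational.Unnormalised.Base as ℚᵘ
import Data.Rational.Unnormalised.Properties as ℚᵘ
open import Data.Sum.Base using (inj₁; inj₂)
open import Data.Vec.Base as Vec using (Vec; []; _∷_; _∷ʳ_)
import Data.Vec.Properties as Vec
open import Function.Base using (_∘_)
open import Function.Bundles using (Inverse; mk⇔)
open import Relation.Binary.PropositionalEquality as ≡
  using (_≡_; _≢_; refl; cong; cong₂; subst; subst₂; setoid; module ≡-Reasoning)
import Relation.Binary.Reasoning.Setoid as SetoidReasoning
open import Relation.Nullary.Decidable using (Dec; yes; no; does; dec-true)
open import Relation.Nullary.Negation using (¬_)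

-- The constants in the formula for `χ-H` come from comparing two cases: off H both kernels have one
-- element and the right side is 0; on H the terms |A_m| and q |A_{m-1}| cancel and q - 1 remains.
-- The transposition step compares orders instead of ranks: |A_d| q^(n-d+1) = |A_{n-d}| q^(d+1),
-- because both sides equal the sum of ψ₀ over the values of one bilinear form, summed in the two
-- possible orders. No theory of dimension enters; the characters needed for the transform already
-- give the duality. The factor q^d is q^(n+1), from the sum over x, divided by the number q^(n-d+1)
-- of forms S. So A_m contributes q^m and q |A_{m-1}| contributes q q^(m-1), the same power. The
-- pairs with Q = 0 are what subtracting 1 from |A_d| removes, and a nonzero divisor Q of P has a
-- single cofactor. Two obstacles shape the computation. Equality in `ℂ` is undecidable and a number
-- that is not 0 has no inverse at hand, so numbers are cancelled rather than divided by. And the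
-- identities are stated as sums with denominators cleared, which also covers the degree -1, where
-- q^d is not an integer.

-- Comparing the lengths of duplicate-free lists.

lookup-injective : ∀ {a} {A : Set a} {xs : List A} → Unique xs → ∀ {i j} →
  List.lookup xs i ≡ List.lookup xs j → i ≡ j
lookup-injective (x∉ ∷ u) {Fin.zero}  {Fin.zero}  eq = refl
lookup-injective (x∉ ∷ u) {Fin.zero}  {Fin.suc j} eq = ⊥-elim (All.lookup x∉ (∈.∈-lookup j) eq)
lookup-injective (x∉ ∷ u) {Fin.suc i} {Fin.zero}  eq = ⊥-elim (All.lookup x∉ (∈.∈-lookup i) (≡.sym eq))
lookup-injective (x∉ ∷ u) {Fin.suc i} {Fin.suc j} eq = cong Fin.suc (lookup-injective u eq)

-- Each position in `xs` goes to the position of its image in `ys`. Injectivity is asked on members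
-- only, since the map (t, B) ↦ t M + Y B is known to be injective only for B in the kernel.
length-≤ : ∀ {a b} {A : Set a} {B : Set b} {xs : List A} (ys : List B) (f : A → B) → Unique xs →
  (∀ {x} → x ∈ xs → f x ∈ ys) →
  (∀ {x y} → x ∈ xs → y ∈ xs → f x ≡ f y → x ≡ y) →
  List.length xs ℕ.≤ List.length ys
length-≤ {xs = xs} ys f u maps inj = Fin.injective⇒≤ {f = λ i → Any.index (maps (∈.∈-lookup {xs = xs} i))} λ {i} {j} eq →
  lookup-injective u (inj (∈.∈-lookup i) (∈.∈-lookup j)
    (∈ₛ.index-injective (setoid _) (maps (∈.∈-lookup i)) (maps (∈.∈-lookup j)) eq))

length-cartesianProductWith : ∀ {a b c} {A : Set a} {B : Set b} {C : Set c} (f : A → B → C) xs ys →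
  List.length (List.cartesianProductWith f xs ys) ≡ List.length xs ℕ.* List.length ys
length-cartesianProductWith f []       ys = refl
length-cartesianProductWith f (x ∷ xs) ys = ≡.trans (List.length-++ (List.map (f x) ys))
  (cong₂ ℕ._+_ (List.length-map (f x) ys) (length-cartesianProductWith f xs ys))

-- Hankel systems and products of binary forms over k.

module Hankel {c : Level} (k : FiniteField c) where
  open FiniteField k
  open ≡ using (sym; trans)
  open CommutativeRing commutativeRing using
    (+-identityˡ; +-identityʳ; *-identityˡ; *-identityʳ; *-assoc; *-comm; -‿inverseˡ; -‿inverseʳ; ring; commutativeSemiring)
  open RingProperties ring using
    (+-cancelʳ; +-cancelˡ; +-inverseˡ-unique; -0#≈0#; -‿distribˡ-*; -‿+-comm; -‿involutive)
  open SemiringSolver commutativeSemiring using (solve; _:+_; _:*_; _:=_; con)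
  open ≡-Reasoning

  -- A vector is read as an infinite sequence continued by zeros, so that passing to the next row of
  -- a Hankel matrix is the shift `s ∘ suc` and leaves no length to adjust.
  Stream : Set c
  Stream = ℕ → Carrier

  infixl 9 _!_
  _!_ : ∀ {N} → Vec Carrier N → Stream
  _!_ = _‼_ k

  0ᵛ : ∀ {N} → Vec Carrier N
  0ᵛ {N} = Vec.replicate N 0#

  dot : ∀ {N} → Vec Carrier N → Stream → Carrier
  dot []       s = 0#
  dot (a ∷ as) s = a * s 0 + dot as (s ∘ suc)

  dot-cong : ∀ {N} (a : Vec Carrier N) {s t : Stream} → (∀ i → s i ≡ t i) → dot a s ≡ dot a t
  dot-cong []       eq = refl
  dot-cong (a ∷ as) eq = cong₂ _+_ (cong (a *_) (eq 0)) (dot-cong as (eq ∘ suc))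

  0*x+y≡y : ∀ x y → 0# * x + y ≡ y
  0*x+y≡y x y = trans (cong (_+ y) (zeroˡ x)) (+-identityˡ y)

  dot-0ᵛ : ∀ N (s : Stream) → dot (0ᵛ {N}) s ≡ 0#
  dot-0ᵛ zero    s = refl
  dot-0ᵛ (suc N) s = trans (0*x+y≡y _ _) (dot-0ᵛ N (s ∘ suc))

  dot-zero : ∀ {N} (a : Vec Carrier N) {s : Stream} → (∀ i → s i ≡ 0#) → dot a s ≡ 0#
  dot-zero []       eq = refl
  dot-zero (a ∷ as) eq = trans (cong₂ _+_ (trans (cong (a *_) (eq 0)) (zeroʳ a)) (dot-zero as (eq ∘ suc)))
    (+-identityˡ 0#)

  -- The product of the Hankel matrix (s (i + j)), with C rows j, and the column a.

  rows : ∀ C {L} → Vec Carrier L → Stream → Vec Carrier C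
  rows zero    a s = []
  rows (suc C) a s = dot a s ∷ rows C a (s ∘ suc)

  rows-[] : ∀ C (s : Stream) i → rows C [] s ! i ≡ 0#
  rows-[] zero    s i       = refl
  rows-[] (suc C) s zero    = refl
  rows-[] (suc C) s (suc i) = rows-[] C (s ∘ suc) i

  rows-∷ : ∀ {L C} (a : Vec Carrier C) b (bs : Vec Carrier L) (s : Stream) →
    dot a (rows C (b ∷ bs) s !_) ≡ b * dot a s + dot a (rows C bs (s ∘ suc) !_)
  rows-∷ []       b bs s = sym (trans (cong (_+ 0#) (zeroʳ b)) (+-identityˡ 0#))
  rows-∷ (a ∷ as) b bs s = trans (cong (a * (b * s 0 + dot bs (s ∘ suc)) +_) (rows-∷ as b bs (s ∘ suc)))
    (solve 6 (λ a b s d e f → a :* (b :* s :+ d) :+ (b :* e :+ f) := b :* (a :* s :+ e) :+ (a :* d :+ f)) refl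
      a b (s 0) (dot bs (s ∘ suc)) (dot as (s ∘ suc)) _)

  -- Both sides are the bilinear form with entries s (i + j). These are symmetric in i and j, so the
  -- transpose of a Hankel matrix is the Hankel matrix of the same sequence with the dimensions
  -- exchanged.
  dot-rows-sym : ∀ {L C} (b : Vec Carrier L) (a : Vec Carrier C) (s : Stream) →
    dot b (rows L a s !_) ≡ dot a (rows C b s !_)
  dot-rows-sym {C = C} []       a s = sym (dot-zero a (rows-[] C s))
  dot-rows-sym         (b ∷ bs) a s = trans (cong (b * dot a s +_) (dot-rows-sym bs a (s ∘ suc)))
    (sym (rows-∷ a b bs s))

  -- The coefficient of Yᵗ in the product of the forms R and Q.

  conv : ∀ {L C} → Vec Carrier L → Vec Carrier C → Stream
  conv R Q t = ∑[ a < suc t ] (R ! toℕ a * Q ! (t ℕ.∸ toℕ a))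

  prefix : ∀ N → Stream → Vec Carrier N
  prefix zero    f = []
  prefix (suc N) f = f 0 ∷ prefix N (f ∘ suc)

  prefix-cong : ∀ N {f g : Stream} → (∀ t → t ℕ.< N → f t ≡ g t) → prefix N f ≡ prefix N g
  prefix-cong zero    eq = refl
  prefix-cong (suc N) eq = cong₂ _∷_ (eq 0 (s≤s z≤n)) (prefix-cong N λ t lt → eq (suc t) (s≤s lt))

  prefix-injective : ∀ N {f g : Stream} → prefix N f ≡ prefix N g → ∀ t → t ℕ.< N → f t ≡ g t
  prefix-injective (suc N) eq zero    _        = Vec.∷-injectiveˡ eq
  prefix-injective (suc N) eq (suc t) (s≤s lt) = prefix-injective N (Vec.∷-injectiveʳ eq) t lt

  prefix-! : ∀ {N} (v : Vec Carrier N) → prefix N (v !_) ≡ v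
  prefix-! []       = refl
  prefix-! (x ∷ xs) = cong (x ∷_) (prefix-! xs)

  prefix-0 : ∀ N {f : Stream} → (∀ t → t ℕ.< N → f t ≡ 0#) → prefix N f ≡ 0ᵛ
  prefix-0 zero    eq = refl
  prefix-0 (suc N) eq = cong₂ _∷_ (eq 0 (s≤s z≤n)) (prefix-0 N λ t lt → eq (suc t) (s≤s lt))

  conv-[]ˡ : ∀ {C} (Q : Vec Carrier C) t → conv [] Q t ≡ 0#
  conv-[]ˡ Q t = sum-zero k {suc t} _ λ a → zeroˡ (Q ! (t ℕ.∸ toℕ a))

  conv-0ʳ : ∀ {L} C (R : Vec Carrier L) t → conv R (0ᵛ {C}) t ≡ 0#
  conv-0ʳ C R t = sum-zero k {suc t} _ λ a → trans (cong (R ! toℕ a *_) (0ᵛ-! C (t ℕ.∸ toℕ a))) (zeroʳ _)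
    where
      0ᵛ-! : ∀ C i → 0ᵛ {C} ! i ≡ 0#
      0ᵛ-! zero    i       = refl
      0ᵛ-! (suc C) zero    = refl
      0ᵛ-! (suc C) (suc i) = 0ᵛ-! C i

  -- Forms with C and L coefficients have a product with C + L - 1 coefficients, so for L + C = N +
  -- 1 the prefix of length N is the whole product.
  Factors : ∀ N C {L} → Vec Carrier N → Vec Carrier L → Set c
  Factors N C P Q = ∃[ S ] prefix N (conv {C} S Q) ≡ P

  dot-prefix-linear : ∀ N b (f g s : Stream) →
    dot (prefix N (λ t → b * f t + g t)) s ≡ b * dot (prefix N f) s + dot (prefix N g) s
  dot-prefix-linear zero    b f g s = sym (trans (cong (_+ 0#) (zeroʳ b)) (+-identityˡ 0#))
  dot-prefix-linear (suc N) b f g s =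
    trans (cong ((b * f 0 + g 0) * s 0 +_) (dot-prefix-linear N b (f ∘ suc) (g ∘ suc) (s ∘ suc)))
      (solve 6 (λ b f g s x y → (b :* f :+ g) :* s :+ (b :* x :+ y) := b :* (f :* s :+ x) :+ (g :* s :+ y)) refl
        b (f 0) (g 0) (s 0) _ _)

  dot-prefix-! : ∀ {L} N (v : Vec Carrier L) (s : Stream) → L ℕ.≤ N → dot (prefix N (v !_)) s ≡ dot v s
  dot-prefix-! N [] s _ = trans (cong (λ w → dot w s) (prefix-0 N λ t lt → refl)) (dot-0ᵛ N s)
  dot-prefix-! (suc N) (x ∷ xs) s (s≤s le) = cong (x * s 0 +_) (dot-prefix-! N xs (s ∘ suc) le)

  dot-[rows] : ∀ {L} (b : Vec Carrier L) (s : Stream) → dot b (rows L [] s !_) ≡ 0#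
  dot-[rows] {L} b s = dot-zero b (rows-[] L s)

  -- Pairing the product R Q with s gives the sum of R_j Q_i s (i + j), which is also R paired with
  -- the Hankel image of Q. This turns the linear system for Q into the conditions ⟨S Q, x⟩ = 0. The
  -- bound on L + C ensures that the prefix omits no coefficient of the product.
  dot-conv : ∀ {L C} N (R : Vec Carrier C) (Q : Vec Carrier L) (s : Stream) → L ℕ.+ C ℕ.≤ suc N →
    dot R (rows C Q s !_) ≡ dot (prefix N (conv R Q)) s
  dot-conv N [] Q s _ = sym (trans (cong (λ w → dot w s) (prefix-0 N λ t _ → conv-[]ˡ Q t)) (dot-0ᵛ N s))
  dot-conv {zero} N (r ∷ rs) [] s _ = trans (dot-[rows] (r ∷ rs) s) (sym
    (trans (cong (λ w → dot w s) (prefix-0 N λ t _ → conv-0ʳ 0 (r ∷ rs) t)) (dot-0ᵛ N s)))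
  dot-conv {suc L} {suc C} zero (r ∷ rs) (x ∷ xs) s (s≤s le) with () ← subst (ℕ._≤ 0) (ℕ.+-suc L C) le
  dot-conv {suc L} {suc C} (suc N) (r ∷ rs) Q@(x ∷ xs) s (s≤s le) = begin
    r * dot Q s + dot rs (rows C Q (s ∘ suc) !_)
      ≡⟨ cong₂ (λ u v → r * u + v) (sym (dot-prefix-! (suc N) Q s (s≤s (ℕ.≤-trans (ℕ.m≤m+n L C) le′))))
           (dot-conv N rs Q (s ∘ suc) (s≤s le′)) ⟩
    r * (x * s 0 + dot (prefix N (xs !_)) (s ∘ suc)) + dot (prefix N (conv rs Q)) (s ∘ suc)
      -- The `con 0` is the empty tail of the one-term sum that `conv` is at 0.
      ≡⟨ solve 5 (λ r x s d e → r :* (x :* s :+ d) :+ e := (r :* x :+ con 0) :* s :+ (r :* d :+ e)) refl r x (s 0) _ _ ⟩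
    (r * x + 0#) * s 0 + (r * dot (prefix N (xs !_)) (s ∘ suc) + dot (prefix N (conv rs Q)) (s ∘ suc))
      ≡⟨ cong ((r * x + 0#) * s 0 +_) (sym (dot-prefix-linear N r (xs !_) (conv rs Q) (s ∘ suc))) ⟩
    dot (prefix (suc N) (conv (r ∷ rs) Q)) s ∎
    where
      le′ : L ℕ.+ C ℕ.≤ N
      le′ = ℕ.s≤s⁻¹ (subst (ℕ._≤ suc N) (ℕ.+-suc L C) le)

  nonzero-cancel : ∀ {a x y} → a ≢ 0# → x * a ≡ y * a → x ≡ y
  nonzero-cancel {a} {x} {y} a≢0 eq = let b , ab≡1 = inverse a a≢0 in begin
    x           ≡⟨ *-identityʳ x ⟨
    x * 1#      ≡⟨ cong (x *_) ab≡1 ⟨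
    x * (a * b) ≡⟨ *-assoc x a b ⟨
    x * a * b   ≡⟨ cong (_* b) eq ⟩
    y * a * b   ≡⟨ *-assoc y a b ⟩
    y * (a * b) ≡⟨ cong (y *_) ab≡1 ⟩
    y * 1#      ≡⟨ *-identityʳ y ⟩
    y           ∎

  conv-0∷ : ∀ {C L} (R : Vec Carrier C) (Q : Vec Carrier L) t → conv R (0# ∷ Q) (suc t) ≡ conv R Q t
  conv-0∷ []       Q t       = trans (conv-[]ˡ (0# ∷ Q) (suc t)) (sym (conv-[]ˡ Q t))
  conv-0∷ (r ∷ rs) Q zero    = cong (r * Q ! 0 +_) (trans (cong (_+ 0#) (zeroʳ _)) (+-identityˡ 0#))
  conv-0∷ (r ∷ rs) Q (suc t) = cong (r * Q ! suc t +_) (conv-0∷ rs Q t)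

  -- There are no zero divisors: a vanishing lowest coefficient of Q is a factor Y, which only
  -- shifts the product, and a nonzero one lets the coefficients of the cofactor be recovered one by
  -- one from the lowest.
  conv-injective : ∀ {L C} N (Q : Vec Carrier L) → Q ≢ 0ᵛ → L ℕ.+ C ℕ.≤ suc N → (R S : Vec Carrier C) →
    (∀ t → t ℕ.< N → conv R Q t ≡ conv S Q t) → R ≡ S
  conv-injective N [] Q≢0 le R S eq = ⊥-elim (Q≢0 refl)
  conv-injective {suc L} N Q Q≢0 le [] [] eq = refl
  conv-injective {suc L} {suc C} zero Q Q≢0 (s≤s le) R S eq with () ← subst (ℕ._≤ 0) (ℕ.+-suc L C) le
  conv-injective {suc L} {suc C} (suc N) (x ∷ xs) Q≢0 (s≤s le) (r ∷ R) (s ∷ S) eq with x ≟ 0#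
  ... | yes refl = conv-injective N xs (λ eq → Q≢0 (cong (0# ∷_) eq)) le (r ∷ R) (s ∷ S)
    λ t lt → trans (sym (conv-0∷ (r ∷ R) xs t)) (trans (eq (suc t) (s≤s lt)) (conv-0∷ (s ∷ S) xs t))
  ... | no  x≢0 = cong₂ _∷_ r≡s
    (conv-injective N (x ∷ xs) Q≢0 (subst (ℕ._≤ suc N) (ℕ.+-suc L C) le) R S
      λ t lt → +-cancelˡ (r * (x ∷ xs) ! suc t) _ _
        (trans (eq (suc t) (s≤s lt)) (cong (λ u → u * (x ∷ xs) ! suc t + conv S (x ∷ xs) t) (sym r≡s))))
    where
      r≡s : r ≡ s
      r≡s = nonzero-cancel x≢0 (+-cancelʳ 0# _ _ (eq 0 (s≤s z≤n)))

  -- Hankel kernels under multiplication by Y and Z.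

  -- For a sequence of N terms the relevant pairs satisfy L + C = N + 1: degree L - 1 comes with C
  -- equations, and lowering the degree by one adds an equation.
  InKernel : ∀ C {L} → Stream → Vec Carrier L → Set c
  InKernel C s a = rows C a s ≡ 0ᵛ

  inKernel? : ∀ C {L} (s : Stream) (a : Vec Carrier L) → Dec (InKernel C s a)
  inKernel? C s a = Vec.≡-dec _≟_ _ _

  -- Of the `suc C` rows for `a`, multiplication by Y keeps all but the first and multiplication by
  -- Z, in `rows-∷ʳ0`, all but the last. Together they see every row.
  rows-0∷ : ∀ C {L} (a : Vec Carrier L) (s : Stream) → rows C (0# ∷ a) s ≡ rows C a (s ∘ suc)
  rows-0∷ zero    a s = refl
  rows-0∷ (suc C) a s = cong₂ _∷_ (0*x+y≡y _ _) (rows-0∷ C a (s ∘ suc))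

  dot-∷ʳ0 : ∀ {L} (a : Vec Carrier L) (s : Stream) → dot (a ∷ʳ 0#) s ≡ dot a s
  dot-∷ʳ0 []       s = 0*x+y≡y _ _
  dot-∷ʳ0 (a ∷ as) s = cong (a * s 0 +_) (dot-∷ʳ0 as (s ∘ suc))

  rows-∷ʳ0 : ∀ C {L} (a : Vec Carrier L) (s : Stream) → rows C (a ∷ʳ 0#) s ≡ rows C a s
  rows-∷ʳ0 zero    a s = refl
  rows-∷ʳ0 (suc C) a s = cong₂ _∷_ (dot-∷ʳ0 a s) (rows-∷ʳ0 C a (s ∘ suc))

  kernel-weaken : ∀ C {L} (s : Stream) (a : Vec Carrier L) → InKernel (suc C) s a → InKernel C s a
  kernel-weaken zero    s a eq = refl
  kernel-weaken (suc C) s a eq =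
    cong₂ _∷_ (Vec.∷-injectiveˡ eq) (kernel-weaken C (s ∘ suc) a (Vec.∷-injectiveʳ eq))

  -- Multiplication by Y is 0# ∷_ and multiplication by Z is _∷ʳ 0#, so a is
  -- not Y times an element of the kernel one degree lower.

  Primitive : (L C : ℕ) → Stream → Vec Carrier (suc L) → Set c
  Primitive L C s a = InKernel C s a × (∀ b → InKernel (suc C) s b → a ≢ 0# ∷ b)

  -- If Z a = Y b, comparing coefficients gives a = Y e and b = Z e. Then Y e and Z e both solve the
  -- system with `suc C` equations, hence e solves the one with one equation more, and a = Y e
  -- contradicts primitivity.
  primitive-∷ʳ0 : ∀ L C s a → Primitive L (suc C) s a → Primitive (suc L) C s (a ∷ʳ 0#)
  primitive-∷ʳ0 L C s (x ∷ e) (ka , prim) =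
    trans (rows-∷ʳ0 C (x ∷ e) s) (kernel-weaken C s (x ∷ e) ka) , not
    where
      not : ∀ b → InKernel (suc C) s b → (x ∷ e) ∷ʳ 0# ≢ 0# ∷ b
      not b kb refl = prim e (cong₂ _∷_ (Vec.∷-injectiveˡ ke) (trans (sym (rows-0∷ (suc C) e s)) ka)) refl
        where
          ke : InKernel (suc C) s e
          ke = trans (sym (rows-∷ʳ0 (suc C) e s)) kb

  -- Factors Y are removed as long as the quotient still lies in the kernel of its degree. This
  -- stops at a primitive form because `a` is not 0, and every removed Y is then replaced by a Z.
  nonzero⇒primitive : ∀ L C s (a : Vec Carrier (suc L)) → InKernel C s a → a ≢ 0ᵛ → ∃ (Primitive L C s)
  nonzero⇒primitive L C s (x ∷ b) ka a≢0 with x ≟ 0# | inKernel? (suc C) s b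
  ... | no x≢0 | _      = x ∷ b , ka , λ _ _ eq → x≢0 (Vec.∷-injectiveˡ eq)
  ... | yes _  | no ¬kb = x ∷ b , ka , λ { _ kb refl → ¬kb kb }
  nonzero⇒primitive zero    C s (x ∷ []) ka a≢0 | yes refl | yes kb = ⊥-elim (a≢0 refl)
  nonzero⇒primitive (suc L) C s (x ∷ b)  ka a≢0 | yes refl | yes kb =
    let e , prim = nonzero⇒primitive L (suc C) s b kb (λ eq → a≢0 (cong (0# ∷_) eq))
    in e ∷ʳ 0# , primitive-∷ʳ0 L C s e prim

  primitive-raise : ∀ d L C s → ∃ (Primitive L (d ℕ.+ C) s) → ∃ (Primitive (d ℕ.+ L) C s)
  primitive-raise zero    L C s p        = p
  primitive-raise (suc d) L C s (a , pa) = subst (λ n → ∃ (Primitive n C s)) (ℕ.+-suc d L)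
    (primitive-raise d (suc L) C s (a ∷ʳ 0# , primitive-∷ʳ0 L (d ℕ.+ C) s a pa))

  axpy : ∀ {N} → Carrier → Vec Carrier N → Vec Carrier N → Vec Carrier N
  axpy t = Vec.zipWith (λ x y → t * x + y)

  dot-axpy : ∀ {N} t (a b : Vec Carrier N) (s : Stream) → dot (axpy t a b) s ≡ t * dot a s + dot b s
  dot-axpy t []       []       s = sym (trans (cong (_+ 0#) (zeroʳ t)) (+-identityˡ 0#))
  dot-axpy t (a ∷ as) (b ∷ bs) s = trans (cong ((t * a + b) * s 0 +_) (dot-axpy t as bs (s ∘ suc)))
    (solve 6 (λ t a b s d e → (t :* a :+ b) :* s :+ (t :* d :+ e) := t :* (a :* s :+ d) :+ (b :* s :+ e)) refl
      t a b (s 0) _ _)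

  0*+0 : ∀ t → t * 0# + 0# ≡ 0#
  0*+0 t = trans (cong (_+ 0#) (zeroʳ t)) (+-identityˡ 0#)

  kernel-axpy : ∀ C {L} s t (a b : Vec Carrier L) → InKernel C s a → InKernel C s b → InKernel C s (axpy t a b)
  kernel-axpy zero    s t a b ka kb = refl
  kernel-axpy (suc C) s t a b ka kb = cong₂ _∷_
    (begin
      dot (axpy t a b) s      ≡⟨ dot-axpy t a b s ⟩
      t * dot a s + dot b s   ≡⟨ cong₂ (λ u v → t * u + v) (Vec.∷-injectiveˡ ka) (Vec.∷-injectiveˡ kb) ⟩
      t * 0# + 0#             ≡⟨ 0*+0 t ⟩
      0#                      ∎)
    (kernel-axpy C (s ∘ suc) t a b (Vec.∷-injectiveʳ ka) (Vec.∷-injectiveʳ kb))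

  kernel-0ᵛ : ∀ C L s → InKernel C s (0ᵛ {L})
  kernel-0ᵛ zero    L s = refl
  kernel-0ᵛ (suc C) L s = cong₂ _∷_ (dot-0ᵛ L s) (kernel-0ᵛ C L (s ∘ suc))

  -- One coordinate of x = (y′ - y) / (t - t′). The right side has the shape of two nested `axpy`,
  -- with the coefficient `- 1#` and the summand `0#`, so that `kernel-axpy` applies to the
  -- resulting vector.
  solve-for : ∀ u t t′ x y y′ → u * (t + - t′) ≡ 1# → t * x + y ≡ t′ * x + y′ → x ≡ u * (- 1# * y + y′) + 0#
  solve-for u t t′ x y y′ inv eq = begin
    x                                      ≡⟨ *-identityˡ x ⟨
    1# * x                                 ≡⟨ cong (_* x) inv ⟨
    u * (t + - t′) * x                     ≡⟨ solve 4 (λ u t n x → u :* (t :+ n) :* x := u :* (t :* x :+ n :* x)) refl u t (- t′) x ⟩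
    u * (t * x + - t′ * x)                 ≡⟨ cong (u *_) (+-cancelʳ y _ _ step) ⟩
    u * (- 1# * y + y′)                    ≡⟨ +-identityʳ _ ⟨
    u * (- 1# * y + y′) + 0#               ∎
    where
      step : (t * x + - t′ * x) + y ≡ (- 1# * y + y′) + y
      step = begin
        (t * x + - t′ * x) + y       ≡⟨ solve 3 (λ a b y → (a :+ b) :+ y := (a :+ y) :+ b) refl (t * x) (- t′ * x) y ⟩
        (t * x + y) + - t′ * x       ≡⟨ cong (_+ - t′ * x) eq ⟩
        (t′ * x + y′) + - t′ * x     ≡⟨ solve 4 (λ t x y n → (t :* x :+ y) :+ n :* x := (t :+ n) :* x :+ y) refl t′ x y′ (- t′) ⟩
        (t′ + - t′) * x + y′         ≡⟨ cong (λ z → z * x + y′) (-‿inverseʳ t′) ⟩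
        0# * x + y′                  ≡⟨ 0*x+y≡y x y′ ⟩
        y′                           ≡⟨ 0*x+y≡y y y′ ⟨
        0# * y + y′                  ≡⟨ cong (λ z → z * y + y′) (-‿inverseˡ 1#) ⟨
        (- 1# + 1#) * y + y′         ≡⟨ solve 3 (λ n y z → (n :+ con 1) :* y :+ z := (n :* y :+ z) :+ y) refl (- 1#) y y′ ⟩
        (- 1# * y + y′) + y          ∎

  axpy-solve : ∀ {N} u t t′ (a b b′ : Vec Carrier N) → u * (t + - t′) ≡ 1# →
    axpy t a b ≡ axpy t′ a b′ → a ≡ axpy u (axpy (- 1#) b b′) 0ᵛ
  axpy-solve u t t′ []       []       []         inv eq = refl
  axpy-solve u t t′ (a ∷ as) (b ∷ bs) (b′ ∷ bs′) inv eq = cong₂ _∷_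
    (solve-for u t t′ a b b′ inv (Vec.∷-injectiveˡ eq)) (axpy-solve u t t′ as bs bs′ inv (Vec.∷-injectiveʳ eq))

  axpy-injectiveʳ : ∀ {N} t (a b b′ : Vec Carrier N) → axpy t a b ≡ axpy t a b′ → b ≡ b′
  axpy-injectiveʳ t []       []       []         eq = refl
  axpy-injectiveʳ t (a ∷ as) (b ∷ bs) (b′ ∷ bs′) eq = cong₂ _∷_
    (+-cancelˡ (t * a) _ _ (Vec.∷-injectiveˡ eq)) (axpy-injectiveʳ t as bs bs′ (Vec.∷-injectiveʳ eq))

  -- For t ≠ t′ the equation could be solved for a = Y (b′ - b) / (t - t′), and the cofactor of Y
  -- lies in the kernel, against primitivity.
  primitive-injective : ∀ L C s a → Primitive L C s a → ∀ t t′ (b b′ : Vec Carrier L) →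
    InKernel (suc C) s b → InKernel (suc C) s b′ →
    axpy t a (0# ∷ b) ≡ axpy t′ a (0# ∷ b′) → t ≡ t′ × b ≡ b′
  primitive-injective L C s a (ka , prim) t t′ b b′ kb kb′ eq with t ≟ t′
  ... | yes refl = refl , Vec.∷-injectiveʳ (axpy-injectiveʳ t a (0# ∷ b) (0# ∷ b′) eq)
  ... | no t≢t′ = ⊥-elim (prim e ke (trans (axpy-solve u t t′ a (0# ∷ b) (0# ∷ b′) inv eq)
      (cong (_∷ e) (trans (cong (λ z → u * z + 0#) (0*+0 (- 1#))) (0*+0 u)))))
    where
      t-t′≢0 : t + - t′ ≢ 0#
      t-t′≢0 z = t≢t′ (+-cancelʳ (- t′) t t′ (trans z (sym (-‿inverseʳ t′))))

      u : Carrier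
      u = proj₁ (inverse _ t-t′≢0)

      inv : u * (t + - t′) ≡ 1#
      inv = trans (*-comm _ _) (proj₂ (inverse _ t-t′≢0))

      e : Vec Carrier L
      e = axpy u (axpy (- 1#) b b′) 0ᵛ

      ke : InKernel (suc C) s e
      ke = kernel-axpy (suc C) s u _ _ (kernel-axpy (suc C) s (- 1#) b b′ kb kb′) (kernel-0ᵛ (suc C) L s)

  kernel-scaled-shift : ∀ L C s a → InKernel C s a → ∀ t (b : Vec Carrier L) → InKernel (suc C) s b →
    InKernel C s (axpy t a (0# ∷ b))
  kernel-scaled-shift L C s a ka t b kb =
    kernel-axpy C s t a (0# ∷ b) ka (trans (rows-0∷ C b s) (Vec.∷-injectiveʳ kb))

  -- Signs: reading S Q + P = 0 as a factorisation of P.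

  axpy-neg : ∀ {N} (v : Vec Carrier N) → axpy 1# (Vec.map -_ v) v ≡ 0ᵛ
  axpy-neg []      = refl
  axpy-neg (x ∷ v) = cong₂ _∷_ (trans (cong (_+ x) (*-identityˡ _)) (-‿inverseˡ x)) (axpy-neg v)

  axpy≡0⇒neg : ∀ {N} (u v : Vec Carrier N) → axpy 1# u v ≡ 0ᵛ → u ≡ Vec.map -_ v
  axpy≡0⇒neg []      []      eq = refl
  axpy≡0⇒neg (x ∷ u) (y ∷ v) eq = cong₂ _∷_
    (+-inverseˡ-unique x y (trans (cong (_+ y) (sym (*-identityˡ x))) (Vec.∷-injectiveˡ eq)))
    (axpy≡0⇒neg u v (Vec.∷-injectiveʳ eq))

  conv-neg : ∀ {C L} (S : Vec Carrier C) (Q : Vec Carrier L) t → conv (Vec.map -_ S) Q t ≡ - conv S Q t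
  conv-neg []      Q t       = trans (conv-[]ˡ Q t) (sym (trans (cong -_ (conv-[]ˡ Q t)) -0#≈0#))
  conv-neg (x ∷ S) Q zero    = trans (cong (_+ 0#) (sym (-‿distribˡ-* x (Q ! 0)))) (trans (+-identityʳ _)
    (cong -_ (sym (+-identityʳ _))))
  conv-neg (x ∷ S) Q (suc t) = trans (cong₂ _+_ (sym (-‿distribˡ-* x (Q ! suc t))) (conv-neg S Q t))
    (-‿+-comm (x * Q ! suc t) (conv S Q t))

  prefix-map : ∀ N (f : Stream) → prefix N (λ t → - f t) ≡ Vec.map -_ (prefix N f)
  prefix-map zero    f = refl
  prefix-map (suc N) f = cong (- f 0 ∷_) (prefix-map N (f ∘ suc))

  map-neg-involutive : ∀ {N} (v : Vec Carrier N) → Vec.map -_ (Vec.map -_ v) ≡ v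
  map-neg-involutive []      = refl
  map-neg-involutive (x ∷ v) = cong₂ _∷_ (-‿involutive x) (map-neg-involutive v)

  product-neg : ∀ N {C L} (S : Vec Carrier C) (Q : Vec Carrier L) →
    prefix N (conv (Vec.map -_ S) Q) ≡ Vec.map -_ (prefix N (conv S Q))
  product-neg N S Q = trans (prefix-cong N λ t _ → conv-neg S Q t) (prefix-map N (conv S Q))

  dot-comm : ∀ {N} (u v : Vec Carrier N) → dot u (v !_) ≡ dot v (u !_)
  dot-comm []      []      = refl
  dot-comm (x ∷ u) (y ∷ v) = cong₂ _+_ (*-comm x y) (dot-comm u v)

-- Orders of the kernels.

module Enumeration {c : Level} (k : FiniteField c) where
  open FiniteField k
  open Hankel k

  elements-unique : Unique elements
  elements-unique = Unique.map⁺ element-injective (Unique.allFin⁺ q)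
    where
      element-injective : ∀ {i j} → Inverse.from enumeration i ≡ Inverse.from enumeration j → i ≡ j
      element-injective {i} {j} eq = ≡.trans (≡.sym (Inverse.strictlyInverseˡ enumeration i))
        (≡.trans (cong (Inverse.to enumeration) eq) (Inverse.strictlyInverseˡ enumeration j))

  vectors-unique : ∀ N → Unique (vectors k N)
  vectors-unique zero    = All.[] ∷ []
  vectors-unique (suc N) = Unique.cartesianProductWith⁺ _∷_ Vec.∷-injective elements-unique (vectors-unique N)

  length-elements : List.length elements ≡ q
  length-elements = ≡.trans (List.length-map _ (List.allFin q)) (List.length-tabulate {n = q} (λ i → i))

  length-vectors : ∀ N → List.length (vectors k N) ≡ q ℕ.^ N
  length-vectors zero    = refl
  length-vectors (suc N) = ≡.trans (length-cartesianProductWith _∷_ elements (vectors k N))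
    (cong₂ ℕ._*_ length-elements (length-vectors N))

  q-nonZero : ℕ.NonZero q
  q-nonZero = ℕ.>-nonZero (ℕ.≤-trans (s≤s z≤n) (Fin.toℕ<n (Inverse.to enumeration 0#)))

  kernel : ∀ L C → Stream → List (Vec Carrier L)
  kernel L C s = List.filter (inKernel? C s) (vectors k L)

  -- With L + C = N + 1 and a sequence of N terms, this is the order of the solution space in degree
  -- L - 1.
  κ : ℕ → ℕ → Stream → ℕ
  κ L C s = List.length (kernel L C s)

  primitive⇒κ-≥ : ∀ L C s → ∃ (Primitive L C s) → q ℕ.* κ L (suc C) s ℕ.≤ κ (suc L) C s
  primitive⇒κ-≥ L C s (a , prim) = subst (ℕ._≤ κ (suc L) C s)
    (≡.trans (length-cartesianProductWith _,_ elements (kernel L (suc C) s)) (cong (ℕ._* κ L (suc C) s) length-elements))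
    (length-≤ (kernel (suc L) C s) (λ (t , b) → axpy t a (0# ∷ b))
      (Unique.cartesianProduct⁺ elements-unique (Unique.filter⁺ (inKernel? (suc C) s) (vectors-unique L)))
      (λ {(t , b)} mem → ∈.∈-filter⁺ (inKernel? C s) (∈-vectors k _)
        (kernel-scaled-shift L C s a (proj₁ prim) t b (member mem)))
      λ {(t , b)} {(t′ , b′)} mem mem′ eq →
        let t≡t′ , b≡b′ = primitive-injective L C s a prim t t′ b b′ (member mem) (member mem′) eq
        in cong₂ _,_ t≡t′ b≡b′)
    where
      member : ∀ {t b} → (t , b) ∈ List.cartesianProduct elements (kernel L (suc C) s) → InKernel (suc C) s b
      member mem = proj₂ (∈.∈-filter⁻ (inKernel? (suc C) s) {xs = vectors k L}
        (proj₂ (∈.∈-cartesianProduct⁻ elements (kernel L (suc C) s) mem)))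

  -- Duality exchanges L and C, so the lower bound of primitive⇒κ-≥ for C + 1
  -- columns is an upper bound for m + 1 columns.

  module _ (duality : ∀ L C s → κ L C s ℕ.* q ℕ.^ C ≡ κ C L s ℕ.* q ℕ.^ L) where

    κ-ratio : ∀ m C s → m ℕ.≤ C → (a : Vec Carrier (suc m)) → InKernel C s a → a ≢ 0ᵛ →
      κ (suc m) C s ≡ q ℕ.* κ m (suc C) s
    κ-ratio m C s m≤C a ka a≢0 = ℕ.≤-antisym
      (ℕ.*-cancelʳ-≤ _ _ (q ℕ.^ C) {{ℕ.m^n≢0 q C {{q-nonZero}}}} upper)
      (primitive⇒κ-≥ m C s prim)
      where
        open ℕ.≤-Reasoning

        prim : ∃ (Primitive m C s)
        prim = nonzero⇒primitive m C s a ka a≢0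

        -- Here m ≤ C is used, which is 2m ≤ n + 1: multiplication by Z, repeated C - m times,
        -- carries the primitive form from degree m to degree C = n + 1 - m.
        raised : ∃ (Primitive C m s)
        raised = subst (λ n → ∃ (Primitive n m s)) (ℕ.m∸n+n≡m m≤C)
          (primitive-raise (C ℕ.∸ m) m m s (subst (λ n → ∃ (Primitive m n s)) (≡.sym (ℕ.m∸n+n≡m m≤C)) prim))

        upper : κ (suc m) C s ℕ.* q ℕ.^ C ℕ.≤ q ℕ.* κ m (suc C) s ℕ.* q ℕ.^ C
        upper = begin
          κ (suc m) C s ℕ.* q ℕ.^ C             ≡⟨ duality (suc m) C s ⟩
          κ C (suc m) s ℕ.* (q ℕ.* q ℕ.^ m)     ≡⟨ ℕ.*-assoc (κ C (suc m) s) q (q ℕ.^ m) ⟨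
          κ C (suc m) s ℕ.* q ℕ.* q ℕ.^ m       ≡⟨ cong (ℕ._* q ℕ.^ m) (ℕ.*-comm (κ C (suc m) s) q) ⟩
          q ℕ.* κ C (suc m) s ℕ.* q ℕ.^ m       ≤⟨ ℕ.*-monoˡ-≤ (q ℕ.^ m) (primitive⇒κ-≥ C m s raised) ⟩
          κ (suc C) m s ℕ.* q ℕ.^ m             ≡⟨ duality m (suc C) s ⟨
          κ m (suc C) s ℕ.* (q ℕ.* q ℕ.^ C)     ≡⟨ ℕ.*-assoc (κ m (suc C) s) q (q ℕ.^ C) ⟨
          κ m (suc C) s ℕ.* q ℕ.* q ℕ.^ C       ≡⟨ cong (ℕ._* q ℕ.^ C) (ℕ.*-comm (κ m (suc C) s) q) ⟩
          q ℕ.* κ m (suc C) s ℕ.* q ℕ.^ C       ∎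

-- Finite sums in a commutative ring.

module Summation (R : CommutativeRing 0ℓ 0ℓ) where
  open CommutativeRing R renaming (refl to ≈-refl; sym to ≈-sym; trans to ≈-trans; setoid to ≈-setoid)
  open Multiples semiring public using () renaming (_×_ to _·_)
  open Multiples semiring using (×1-homo-*; ×-homo-1)
  open SetoidReasoning ≈-setoid
  open SemiringSolver commutativeSemiring using (solve; _:+_; _:*_; _:=_; con)

  ι : ℕ → Carrier
  ι n = n · 1#

  ι-* : ∀ a b → ι (a ℕ.* b) ≈ ι a * ι b
  ι-* = ×1-homo-*

  ι-1 : ι 1 ≈ 1#
  ι-1 = ×-homo-1 1#

  ι-cong : ∀ {a b} → a ≡ b → ι a ≈ ι b
  ι-cong refl = ≈-refl

  Σ : ∀ {a} {A : Set a} → List A → (A → Carrier) → Carrier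
  Σ xs f = List.foldr _+_ 0# (List.map f xs)

  module _ {a} {A : Set a} where

    Σ-cong : ∀ (xs : List A) {f g : A → Carrier} → (∀ x → f x ≈ g x) → Σ xs f ≈ Σ xs g
    Σ-cong []       eq = ≈-refl
    Σ-cong (x ∷ xs) eq = +-cong (eq x) (Σ-cong xs eq)

    Σ-0 : ∀ (xs : List A) → Σ xs (λ _ → 0#) ≈ 0#
    Σ-0 []       = ≈-refl
    Σ-0 (x ∷ xs) = ≈-trans (+-identityˡ _) (Σ-0 xs)

    Σ-+ : ∀ (xs : List A) (f g : A → Carrier) → Σ xs (λ x → f x + g x) ≈ Σ xs f + Σ xs g
    Σ-+ []       f g = ≈-sym (+-identityˡ 0#)
    Σ-+ (x ∷ xs) f g = ≈-trans (+-congˡ (Σ-+ xs f g))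
      (solve 4 (λ a b c d → (a :+ b) :+ (c :+ d) := (a :+ c) :+ (b :+ d)) ≈-refl _ _ _ _)

    Σ-*ˡ : ∀ (xs : List A) z (f : A → Carrier) → Σ xs (λ x → z * f x) ≈ z * Σ xs f
    Σ-*ˡ []       z f = ≈-sym (zeroʳ z)
    Σ-*ˡ (x ∷ xs) z f = ≈-trans (+-congˡ (Σ-*ˡ xs z f)) (≈-sym (distribˡ z (f x) (Σ xs f)))

    Σ-*ʳ : ∀ (xs : List A) z (f : A → Carrier) → Σ xs (λ x → f x * z) ≈ Σ xs f * z
    Σ-*ʳ xs z f = ≈-trans (Σ-cong xs λ x → *-comm (f x) z) (≈-trans (Σ-*ˡ xs z f) (*-comm z _))

    Σ-const : ∀ (xs : List A) z → Σ xs (λ _ → z) ≈ ι (List.length xs) * z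
    Σ-const []       z = ≈-sym (zeroˡ z)
    Σ-const (x ∷ xs) z = ≈-trans (+-cong (≈-sym (*-identityˡ z)) (Σ-const xs z)) (≈-sym (distribʳ z 1# _))

    Σ-++ : ∀ (xs ys : List A) f → Σ (xs List.++ ys) f ≈ Σ xs f + Σ ys f
    Σ-++ []       ys f = ≈-sym (+-identityˡ _)
    Σ-++ (x ∷ xs) ys f = ≈-trans (+-congˡ (Σ-++ xs ys f)) (≈-sym (+-assoc _ _ _))

    Σ-↭ : ∀ {xs ys : List A} f → xs ↭ ys → Σ xs f ≈ Σ ys f
    Σ-↭ f p = ↭ₛ.foldr-commMonoid ≈-setoid +-isCommutativeMonoid (↭⇒↭ₛ′ isEquivalence (↭.map⁺ f p))

    Σ-map : ∀ {b} {B : Set b} (xs : List B) (g : B → A) f → Σ (List.map g xs) f ≡ Σ xs (f ∘ g)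
    Σ-map []       g f = refl
    Σ-map (x ∷ xs) g f = cong (f (g x) +_) (Σ-map xs g f)

  Σ-swap : ∀ {a b} {A : Set a} {B : Set b} (xs : List A) (ys : List B) (f : A → B → Carrier) →
    Σ xs (λ x → Σ ys (f x)) ≈ Σ ys (λ y → Σ xs (λ x → f x y))
  Σ-swap []       ys f = ≈-sym (Σ-0 ys)
  Σ-swap (x ∷ xs) ys f = ≈-trans (+-congˡ (Σ-swap xs ys f)) (≈-sym (Σ-+ ys (f x) _))

  Σ-cartesianProductWith : ∀ {a b c} {A : Set a} {B : Set b} {C : Set c} (g : A → B → C) xs ys (f : C → Carrier) →
    Σ (List.cartesianProductWith g xs ys) f ≈ Σ xs (λ x → Σ ys (λ y → f (g x y)))
  Σ-cartesianProductWith g []       ys f = ≈-refl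
  Σ-cartesianProductWith g (x ∷ xs) ys f = ≈-trans (Σ-++ (List.map (g x) ys) _ f)
    (+-cong (reflexive (Σ-map ys (g x) f)) (Σ-cartesianProductWith g xs ys f))

  -- The Iverson bracket, written through `does` so that over `ℂ` it agrees with `χ-H` by
  -- definition.
  [_] : ∀ {p} {P : Set p} → Dec P → Carrier
  [ P? ] = if does P? then 1# else 0#

  []-yes : ∀ {p} {P : Set p} (P? : Dec P) → P → [ P? ] ≈ 1#
  []-yes (yes _) _ = ≈-refl
  []-yes (no ¬p) p = ⊥-elim (¬p p)

  []-no : ∀ {p} {P : Set p} (P? : Dec P) → ¬ P → [ P? ] ≈ 0#
  []-no (yes p) ¬p = ⊥-elim (¬p p)
  []-no (no _)  _  = ≈-refl

  []-⇔ : ∀ {p q} {P : Set p} {Q : Set q} (P? : Dec P) (Q? : Dec Q) → (P → Q) → (Q → P) → [ P? ] ≈ [ Q? ]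
  []-⇔ (yes p) Q? to from = ≈-sym ([]-yes Q? (to p))
  []-⇔ (no ¬p) Q? to from = ≈-sym ([]-no Q? (¬p ∘ from))

  Σ-[] : ∀ {a p} {A : Set a} {P : A → Set p} (P? : ∀ x → Dec (P x)) xs →
    Σ xs (λ x → [ P? x ]) ≈ ι (List.length (List.filter P? xs))
  Σ-[] P? []       = ≈-refl
  Σ-[] P? (x ∷ xs) with P? x
  ... | yes _ = +-congˡ (Σ-[] P? xs)
  ... | no  _ = ≈-trans (+-identityˡ _) (Σ-[] P? xs)

  Σ-none : ∀ {a p} {A : Set a} {P : A → Set p} (P? : ∀ x → Dec (P x)) xs → (∀ {x} → x ∈ xs → ¬ P x) →
    Σ xs (λ x → [ P? x ]) ≈ 0#
  Σ-none P? []       none = ≈-refl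
  Σ-none P? (x ∷ xs) none = ≈-trans (+-cong ([]-no (P? x) (none (Any.here refl))) (Σ-none P? xs (none ∘ Any.there)))
    (+-identityˡ 0#)

  Σ-unique : ∀ {a p} {A : Set a} {P : A → Set p} (P? : ∀ x → Dec (P x)) {xs} → Unique xs →
    ∀ {w} → w ∈ xs → P w → (∀ x → P x → x ≡ w) → Σ xs (λ x → [ P? x ]) ≈ 1#
  Σ-unique P? {x ∷ xs} (x∉ ∷ u) (Any.here refl) Pw uniq = ≈-trans
    (+-cong ([]-yes (P? x) Pw) (Σ-none P? xs λ y∈ Py → All.lookup x∉ y∈ (≡.sym (uniq _ Py)))) (+-identityʳ 1#)
  Σ-unique P? {x ∷ xs} (x∉ ∷ u) (Any.there w∈) Pw uniq = ≈-trans
    (+-cong ([]-no (P? x) λ Px → All.lookup x∉ w∈ (uniq x Px)) (Σ-unique P? u w∈ Pw uniq)) (+-identityˡ 1#)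

-- Character sums and the transform of the kernel orders.

module Transform {c : Level} (k : FiniteField c) (R : CommutativeRing 0ℓ 0ℓ) where
  private
    module k = FiniteField k
    module R = CommutativeRing R

  open Summation R

  -- Constructively ψ e ≉ 1 gives no inverse of 1 - ψ e, so that cancelling
  -- 1 - ψ e is the form in which nontriviality is assumed.

  module WithCharacter
    (ψ : k.Carrier → R.Carrier)
    (ψ-homo : ∀ a b → ψ (a k.+ b) R.≈ ψ a R.* ψ b)
    (ψ-0 : ψ k.0# R.≈ R.1#)
    (e : k.Carrier)
    (ψe-fixed⇒0 : ∀ x → ψ e R.* x R.≈ x → x R.≈ R.0#)
    (ι-injective : ∀ a b → ι a R.≈ ι b → a ≡ b)
    (ι-cancel : ∀ a → ℕ.NonZero a → ∀ x y → ι a R.* x R.≈ ι a R.* y → x R.≈ y)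
    where

    open R using (_≈_; _+_; _*_; 0#; 1#; +-cong; +-congˡ; +-congʳ; *-cong; *-congˡ; *-congʳ;
                  *-identityˡ; *-identityʳ; *-assoc; *-comm; zeroˡ; zeroʳ; +-identityˡ; +-identityʳ)
      renaming (refl to ≈-refl; sym to ≈-sym; trans to ≈-trans; setoid to ≈-setoid)
    open Hankel k
    open Enumeration k
    open FiniteField k using (q; elements; ∈-elements; inverse; _≟_)
    open CommutativeRing k.commutativeRing using ()
      renaming (zeroʳ to k-zeroʳ; distribʳ to k-distribʳ; *-assoc to k-*-assoc; *-comm to k-*-comm;
                *-identityˡ to k-*-identityˡ; *-identityʳ to k-*-identityʳ; +-assoc to k-+-assoc; +-identityˡ to k-+-identityˡ;
                +-identityʳ to k-+-identityʳ; -‿inverseˡ to k-inverseˡ; ring to k-ring)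
    open RingProperties k-ring using () renaming (+-cancelʳ to k-+-cancelʳ)
    open RingProperties R.ring using () renaming (+-cancelʳ to R-+-cancelʳ)
    open SetoidReasoning ≈-setoid
    open SemiringSolver R.commutativeSemiring using (solve; _:+_; _:*_; _:=_; con)

    K : Set c
    K = k.Carrier

    -- Duplicate-free lists with the same members are permutations of each other, so only a preimage
    -- x - b is needed.
    shift-↭ : ∀ b → List.map (k._+ b) elements ↭ elements
    shift-↭ b = ∼bag⇒↭ (unique∧set⇒bag (Unique.map⁺ (k-+-cancelʳ b _ _) elements-unique) elements-unique
      (mk⇔ (λ _ → ∈-elements _) (λ _ → shifted-∈ _)))
      where
        shifted-∈ : ∀ x → x ∈ List.map (k._+ b) elements
        shifted-∈ x = subst (_∈ List.map (k._+ b) elements)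
          (≡.trans (k-+-assoc x (k.- b) b) (≡.trans (cong (x k.+_) (k-inverseˡ b)) (k-+-identityʳ x)))
          (∈.∈-map⁺ (k._+ b) (∈-elements (x k.+ k.- b)))

    -- Translating t by e / a permutes k and multiplies every term by ψ e, so the sum is fixed under
    -- multiplication by ψ e.
    Σψ-nonzero : ∀ a → a ≢ k.0# → Σ elements (λ t → ψ (t k.* a)) ≈ 0#
    Σψ-nonzero a a≢0 = ψe-fixed⇒0 _ (begin
      ψ e * Σ elements (λ t → ψ (t k.* a))               ≈⟨ Σ-*ˡ elements (ψ e) _ ⟨
      Σ elements (λ t → ψ e * ψ (t k.* a))               ≈⟨ Σ-cong elements ψ-shifted ⟩
      Σ elements (λ t → ψ ((t k.+ b) k.* a))             ≈⟨ R.reflexive (Σ-map elements (k._+ b) _) ⟨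
      Σ (List.map (k._+ b) elements) (λ t → ψ (t k.* a)) ≈⟨ Σ-↭ _ (shift-↭ b) ⟩
      Σ elements (λ t → ψ (t k.* a))                     ∎)
      where
        a⁻¹ : K
        a⁻¹ = proj₁ (inverse a a≢0)

        b : K
        b = e k.* a⁻¹

        shifted : ∀ t → (t k.+ b) k.* a ≡ t k.* a k.+ e
        shifted t = ≡.trans (k-distribʳ a t b) (cong (t k.* a k.+_)
          (≡.trans (k-*-assoc e a⁻¹ a) (≡.trans (cong (e k.*_) (≡.trans (k-*-comm a⁻¹ a) (proj₂ (inverse a a≢0)))) (k-*-identityʳ e))))

        ψ-shifted : ∀ t → ψ e * ψ (t k.* a) ≈ ψ ((t k.+ b) k.* a)
        ψ-shifted t = ≈-trans (*-comm _ _) (≈-sym (≈-trans (R.reflexive (cong ψ (shifted t))) (ψ-homo _ _)))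

    infix 4 _≟ᵛ_
    _≟ᵛ_ : ∀ {N} (u v : Vec K N) → Dec (u ≡ v)
    _≟ᵛ_ = Vec.≡-dec _≟_

    -- Since ψ turns sums into products, the sum factors over the coordinates of v; a coordinate 0
    -- contributes q and any other contributes 0.
    orthogonality : ∀ {N} (v : Vec K N) → Σ (vectors k N) (λ b → ψ (dot b (v !_))) ≈ ι (q ℕ.^ N) * [ v ≟ᵛ 0ᵛ ]
    orthogonality []      = ≈-trans (R.+-identityʳ _) (≈-trans ψ-0 (≈-sym (≈-trans (*-congʳ ι-1) (*-identityˡ 1#))))
    orthogonality {suc N} (a ∷ v) = begin
      Σ (vectors k (suc N)) (λ b → ψ (dot b ((a ∷ v) !_)))
        ≈⟨ Σ-cartesianProductWith _∷_ elements (vectors k N) _ ⟩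
      Σ elements (λ t → Σ (vectors k N) (λ b → ψ (t k.* a k.+ dot b (v !_))))
        ≈⟨ Σ-cong elements (λ t → ≈-trans (Σ-cong (vectors k N) λ b → ψ-homo _ _) (Σ-*ˡ (vectors k N) (ψ (t k.* a)) _)) ⟩
      Σ elements (λ t → ψ (t k.* a) * Σ (vectors k N) (λ b → ψ (dot b (v !_))))
        ≈⟨ Σ-*ʳ elements _ _ ⟩
      Σ elements (λ t → ψ (t k.* a)) * Σ (vectors k N) (λ b → ψ (dot b (v !_)))
        ≈⟨ *-congˡ (orthogonality v) ⟩
      Σ elements (λ t → ψ (t k.* a)) * (ι (q ℕ.^ N) * [ v ≟ᵛ 0ᵛ ])
        ≈⟨ by-head (a ≟ k.0#) ⟩
      ι (q ℕ.^ suc N) * [ a ∷ v ≟ᵛ 0ᵛ ] ∎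
      where
        by-head : Dec (a ≡ k.0#) → Σ elements (λ t → ψ (t k.* a)) * (ι (q ℕ.^ N) * [ v ≟ᵛ 0ᵛ ]) ≈ ι (q ℕ.^ suc N) * [ a ∷ v ≟ᵛ 0ᵛ ]
        by-head (yes refl) = begin
          Σ elements (λ t → ψ (t k.* k.0#)) * (ι (q ℕ.^ N) * [ v ≟ᵛ 0ᵛ ])
            ≈⟨ *-congʳ (≈-trans (Σ-cong elements λ t → ≈-trans (R.reflexive (cong ψ (k-zeroʳ t))) ψ-0) (Σ-const elements 1#)) ⟩
          (ι (List.length elements) * 1#) * (ι (q ℕ.^ N) * [ v ≟ᵛ 0ᵛ ])
            ≈⟨ *-congʳ (≈-trans (*-identityʳ _) (ι-cong length-elements)) ⟩
          ι q * (ι (q ℕ.^ N) * [ v ≟ᵛ 0ᵛ ])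
            ≈⟨ *-assoc _ _ _ ⟨
          (ι q * ι (q ℕ.^ N)) * [ v ≟ᵛ 0ᵛ ]
            ≈⟨ *-cong (≈-sym (ι-* q (q ℕ.^ N))) ([]-⇔ (v ≟ᵛ 0ᵛ) (k.0# ∷ v ≟ᵛ 0ᵛ) (cong (k.0# ∷_)) Vec.∷-injectiveʳ) ⟩
          ι (q ℕ.^ suc N) * [ k.0# ∷ v ≟ᵛ 0ᵛ ] ∎
        by-head (no a≢0) = begin
          Σ elements (λ t → ψ (t k.* a)) * (ι (q ℕ.^ N) * [ v ≟ᵛ 0ᵛ ])
            ≈⟨ *-congʳ (Σψ-nonzero a a≢0) ⟩
          0# * (ι (q ℕ.^ N) * [ v ≟ᵛ 0ᵛ ])
            ≈⟨ zeroˡ _ ⟩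
          0#
            ≈⟨ zeroʳ _ ⟨
          ι (q ℕ.^ suc N) * 0#
            ≈⟨ *-congˡ ([]-no (a ∷ v ≟ᵛ 0ᵛ) (a≢0 ∘ Vec.∷-injectiveˡ)) ⟨
          ι (q ℕ.^ suc N) * [ a ∷ v ≟ᵛ 0ᵛ ] ∎

    Σψ-rows : ∀ L C s → Σ (vectors k L) (λ a → Σ (vectors k C) (λ b → ψ (dot b (rows C a s !_)))) ≈ ι (q ℕ.^ C) * ι (κ L C s)
    Σψ-rows L C s = begin
      Σ (vectors k L) (λ a → Σ (vectors k C) (λ b → ψ (dot b (rows C a s !_))))
        ≈⟨ Σ-cong (vectors k L) (λ a → orthogonality (rows C a s)) ⟩
      Σ (vectors k L) (λ a → ι (q ℕ.^ C) * [ inKernel? C s a ])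
        ≈⟨ Σ-*ˡ (vectors k L) (ι (q ℕ.^ C)) _ ⟩
      ι (q ℕ.^ C) * Σ (vectors k L) (λ a → [ inKernel? C s a ])
        ≈⟨ *-congˡ (Σ-[] (inKernel? C s) (vectors k L)) ⟩
      ι (q ℕ.^ C) * ι (κ L C s) ∎

    -- This is equality of row rank and column rank in terms of orders. The sum of ψ (b · H a) over
    -- all a and b counts the kernel of H when b is summed first and the kernel of its transpose
    -- when a is summed first.
    κ-duality : ∀ L C s → κ L C s ℕ.* q ℕ.^ C ≡ κ C L s ℕ.* q ℕ.^ L
    κ-duality L C s = ι-injective _ _ (begin
      ι (κ L C s ℕ.* q ℕ.^ C)
        ≈⟨ ι-* (κ L C s) (q ℕ.^ C) ⟩
      ι (κ L C s) * ι (q ℕ.^ C)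
        ≈⟨ *-comm _ _ ⟩
      ι (q ℕ.^ C) * ι (κ L C s)
        ≈⟨ Σψ-rows L C s ⟨
      Σ (vectors k L) (λ a → Σ (vectors k C) (λ b → ψ (dot b (rows C a s !_))))
        ≈⟨ Σ-swap (vectors k L) (vectors k C) _ ⟩
      Σ (vectors k C) (λ b → Σ (vectors k L) (λ a → ψ (dot b (rows C a s !_))))
        ≈⟨ Σ-cong (vectors k C) (λ b → Σ-cong (vectors k L) λ a → R.reflexive (cong ψ (dot-rows-sym a b s))) ⟨
      Σ (vectors k C) (λ b → Σ (vectors k L) (λ a → ψ (dot a (rows L b s !_))))
        ≈⟨ Σψ-rows C L s ⟩
      ι (q ℕ.^ L) * ι (κ C L s)
        ≈⟨ *-comm _ _ ⟩
      ι (κ C L s) * ι (q ℕ.^ L)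
        ≈⟨ ι-* (κ C L s) (q ℕ.^ L) ⟨
      ι (κ C L s ℕ.* q ℕ.^ L) ∎)

    Σψ-dot : ∀ {N} (v : Vec K N) → Σ (vectors k N) (λ x → ψ (dot v (x !_))) ≈ ι (q ℕ.^ N) * [ v ≟ᵛ 0ᵛ ]
    Σψ-dot {N} v = ≈-trans (Σ-cong (vectors k N) λ x → R.reflexive (cong ψ (dot-comm v x))) (orthogonality v)

    -- The transform at P of the constant function 1; `X` is that of the kernel order. This `Y` is
    -- not the variable of the forms.
    Y : ∀ {N} → Vec K N → R.Carrier
    Y {N} P = Σ (vectors k N) λ x → ψ (dot P (x !_))

    X : ∀ L C {N} → Vec K N → R.Carrier
    X L C {N} P = Σ (vectors k N) λ x → ι (κ L C (x !_)) * ψ (dot P (x !_))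

    module _ (N L C : ℕ) (size : L ℕ.+ C ≡ suc N) (P : Vec K N) where

      relation? : (Q : Vec K L) (S : Vec K C) → Dec (axpy k.1# (prefix N (conv S Q)) P ≡ 0ᵛ)
      relation? Q S = axpy k.1# (prefix N (conv S Q)) P ≟ᵛ 0ᵛ

      -- Summing over x first leaves the pairs (Q, S) with S Q + P = 0.

      X-relations : ι (q ℕ.^ C) * X L C P ≈ ι (q ℕ.^ N) * Σ (vectors k L) (λ Q → Σ (vectors k C) λ S → [ relation? Q S ])
      X-relations = begin
        ι (q ℕ.^ C) * X L C P
          ≈⟨ Σ-*ˡ (vectors k N) (ι (q ℕ.^ C)) _ ⟨
        Σ (vectors k N) (λ x → ι (q ℕ.^ C) * (ι (κ L C (x !_)) * ψ (dot P (x !_))))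
          ≈⟨ Σ-cong (vectors k N) (λ x → ≈-trans (≈-sym (*-assoc _ _ _)) (*-congʳ (≈-sym (Σψ-rows L C (x !_))))) ⟩
        Σ (vectors k N) (λ x → Σ (vectors k L) (λ Q → Σ (vectors k C) (λ S → ψ (dot S (rows C Q (x !_) !_)))) * ψ (dot P (x !_)))
          ≈⟨ Σ-cong (vectors k N) (λ x → ≈-trans (≈-sym (Σ-*ʳ (vectors k L) _ _)) (Σ-cong (vectors k L) λ Q →
               ≈-trans (≈-sym (Σ-*ʳ (vectors k C) _ _)) (Σ-cong (vectors k C) λ S → combine x Q S))) ⟩
        Σ (vectors k N) (λ x → Σ (vectors k L) (λ Q → Σ (vectors k C) (λ S → ψ (dot (axpy k.1# (prefix N (conv S Q)) P) (x !_)))))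
          ≈⟨ Σ-swap (vectors k N) (vectors k L) _ ⟩
        Σ (vectors k L) (λ Q → Σ (vectors k N) (λ x → Σ (vectors k C) (λ S → ψ (dot (axpy k.1# (prefix N (conv S Q)) P) (x !_)))))
          ≈⟨ Σ-cong (vectors k L) (λ Q → Σ-swap (vectors k N) (vectors k C) _) ⟩
        Σ (vectors k L) (λ Q → Σ (vectors k C) (λ S → Σ (vectors k N) (λ x → ψ (dot (axpy k.1# (prefix N (conv S Q)) P) (x !_)))))
          ≈⟨ Σ-cong (vectors k L) (λ Q → ≈-trans
               (Σ-cong (vectors k C) λ S → Σψ-dot (axpy k.1# (prefix N (conv S Q)) P)) (Σ-*ˡ (vectors k C) _ _)) ⟩
        Σ (vectors k L) (λ Q → ι (q ℕ.^ N) * Σ (vectors k C) (λ S → [ relation? Q S ]))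
          ≈⟨ Σ-*ˡ (vectors k L) _ _ ⟩
        ι (q ℕ.^ N) * Σ (vectors k L) (λ Q → Σ (vectors k C) λ S → [ relation? Q S ]) ∎
        where
          combine : ∀ (x : Vec K N) (Q : Vec K L) (S : Vec K C) →
            ψ (dot S (rows C Q (x !_) !_)) * ψ (dot P (x !_)) ≈ ψ (dot (axpy k.1# (prefix N (conv S Q)) P) (x !_))
          combine x Q S = ≈-trans (≈-sym (ψ-homo _ _)) (R.reflexive (cong ψ (≡.trans
            (cong (k._+ dot P (x !_)) (≡.trans (dot-conv N S Q (x !_) (ℕ.≤-reflexive size)) (≡.sym (k-*-identityˡ _))))
            (≡.sym (dot-axpy k.1# (prefix N (conv S Q)) P (x !_))))))

      module _ {p} {D : Vec K L → Set p} (D? : ∀ Q → Dec (D Q))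
        (D⇒≢0 : ∀ Q → D Q → Q ≢ 0ᵛ) (D⇒factors : ∀ Q → D Q → Factors N C P Q)
        (factors⇒D : ∀ Q → Q ≢ 0ᵛ → Factors N C P Q → D Q) where

        δ : ℕ
        δ = List.length (List.filter D? (vectors k L))

        -- `D Q` stands for: Q is nonzero and divides P. For Q = 0 the relation S Q + P = 0 says P =
        -- 0, whatever S is; for Q ≠ 0 cancellation leaves at most one S, and there is one exactly
        -- when Q divides P.
        Σ-relations : ∀ Q → Σ (vectors k C) (λ S → [ relation? Q S ]) ≈ ι (q ℕ.^ C) * [ P ≟ᵛ 0ᵛ ] * [ Q ≟ᵛ 0ᵛ ] + [ D? Q ]
        Σ-relations Q with Q ≟ᵛ 0ᵛ | D? Q
        ... | yes refl | yes DQ = ⊥-elim (D⇒≢0 Q DQ refl)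
        ... | yes refl | no _   = begin
          Σ (vectors k C) (λ S → [ relation? Q S ])
            ≈⟨ Σ-cong (vectors k C) (λ S → []-⇔ (relation? Q S) (P ≟ᵛ 0ᵛ) (≡.trans (≡.sym (trivial S))) (≡.trans (trivial S))) ⟩
          Σ (vectors k C) (λ S → [ P ≟ᵛ 0ᵛ ])
            ≈⟨ Σ-const (vectors k C) _ ⟩
          ι (List.length (vectors k C)) * [ P ≟ᵛ 0ᵛ ]
            ≈⟨ *-congʳ (ι-cong (length-vectors C)) ⟩
          ι (q ℕ.^ C) * [ P ≟ᵛ 0ᵛ ]
            ≈⟨ ≈-trans (+-identityʳ _) (*-identityʳ _) ⟨
          ι (q ℕ.^ C) * [ P ≟ᵛ 0ᵛ ] * 1# + 0# ∎
          where
            axpy-0 : ∀ {N} (v : Vec K N) → axpy k.1# 0ᵛ v ≡ v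
            axpy-0 []      = refl
            axpy-0 (x ∷ v) = cong₂ _∷_ (≡.trans (cong (k._+ x) (k-zeroʳ k.1#)) (k-+-identityˡ x)) (axpy-0 v)

            trivial : ∀ S → axpy k.1# (prefix N (conv S (0ᵛ {L}))) P ≡ P
            trivial S = ≡.trans (cong (λ v → axpy k.1# v P) (prefix-0 N λ t _ → conv-0ʳ L S t)) (axpy-0 P)
        ... | no Q≢0 | yes DQ = ≈-trans
          (Σ-unique (relation? Q) (vectors-unique C) (∈-vectors k T) T-relation T-unique)
          (≈-sym (≈-trans (+-congʳ (zeroʳ _)) (+-identityˡ 1#)))
          where
            T : Vec K C
            T = Vec.map k.-_ (proj₁ (D⇒factors Q DQ))

            T-product : prefix N (conv T Q) ≡ Vec.map k.-_ P
            T-product = ≡.trans (product-neg N (proj₁ (D⇒factors Q DQ)) Q) (cong (Vec.map k.-_) (proj₂ (D⇒factors Q DQ)))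

            T-relation : axpy k.1# (prefix N (conv T Q)) P ≡ 0ᵛ
            T-relation = ≡.trans (cong (λ v → axpy k.1# v P) T-product) (axpy-neg P)

            T-unique : ∀ S → axpy k.1# (prefix N (conv S Q)) P ≡ 0ᵛ → S ≡ T
            T-unique S rel = conv-injective N Q Q≢0 (ℕ.≤-reflexive size) S T
              (prefix-injective N (≡.trans (axpy≡0⇒neg _ P rel) (≡.sym T-product)))
        ... | no Q≢0 | no ¬DQ = ≈-trans
          (Σ-none (relation? Q) (vectors k C) λ {S} _ rel → ¬DQ (factors⇒D Q Q≢0 (Vec.map k.-_ S ,
            ≡.trans (product-neg N S Q) (≡.trans (cong (Vec.map k.-_) (axpy≡0⇒neg _ P rel)) (map-neg-involutive P)))))
          (≈-sym (≈-trans (+-congʳ (zeroʳ _)) (+-identityˡ 0#)))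

        -- Dividing `X-relations` by q^C leaves the power q^N / q^C = q^(L-1) in front of `δ`. Both
        -- sides carry an extra factor q because L = 0, the degree -1, is among the cases.
        X-value : ι q * X L C P ≈ ι q * Y P + ι (q ℕ.^ L) * ι δ
        X-value = ι-cancel (q ℕ.^ C) (ℕ.m^n≢0 q C {{q-nonZero}}) _ _ (begin
          qᶜ * (ι q * X L C P)
            ≈⟨ solve 3 (λ a b c → a :* (b :* c) := b :* (a :* c)) ≈-refl _ _ _ ⟩
          ι q * (qᶜ * X L C P)
            ≈⟨ *-congˡ X-relations ⟩
          ι q * (ι (q ℕ.^ N) * Σ (vectors k L) (λ Q → Σ (vectors k C) λ S → [ relation? Q S ]))
            ≈⟨ *-congˡ (*-congˡ (Σ-cong (vectors k L) Σ-relations)) ⟩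
          ι q * (ι (q ℕ.^ N) * Σ (vectors k L) (λ Q → z * [ Q ≟ᵛ 0ᵛ ] + [ D? Q ]))
            ≈⟨ *-congˡ (*-congˡ (≈-trans (Σ-+ (vectors k L) _ _) (+-cong (Σ-*ˡ (vectors k L) z _) (Σ-[] D? (vectors k L))))) ⟩
          ι q * (ι (q ℕ.^ N) * (z * Σ (vectors k L) (λ Q → [ Q ≟ᵛ 0ᵛ ]) + ι δ))
            ≈⟨ *-congˡ (*-congˡ (+-congʳ (*-congˡ (Σ-unique (_≟ᵛ 0ᵛ) (vectors-unique L) (∈-vectors k 0ᵛ) refl λ _ eq → eq)))) ⟩
          ι q * (ι (q ℕ.^ N) * (qᶜ * [ P ≟ᵛ 0ᵛ ] * 1# + ι δ))
            ≈⟨ solve 5 (λ a b c d e → a :* (b :* (c :* d :* con 1 :+ e)) := c :* (a :* (b :* d)) :+ (a :* b) :* e) ≈-refl _ _ _ _ _ ⟩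
          qᶜ * (ι q * (ι (q ℕ.^ N) * [ P ≟ᵛ 0ᵛ ])) + (ι q * ι (q ℕ.^ N)) * ι δ
            -- The pairs with Q = 0 are rewritten as `Y P`, so that later they cancel against the
            -- transforms of constants without being evaluated.
            ≈⟨ +-cong (*-congˡ (*-congˡ (≈-sym (Σψ-dot P)))) (*-congʳ powers) ⟩
          qᶜ * (ι q * Y P) + (ι (q ℕ.^ L) * qᶜ) * ι δ
            ≈⟨ solve 4 (λ a b c d → a :* b :+ (c :* a) :* d := a :* (b :+ c :* d)) ≈-refl _ _ _ _ ⟩
          qᶜ * (ι q * Y P + ι (q ℕ.^ L) * ι δ) ∎)
          where
            qᶜ z : R.Carrier
            qᶜ = ι (q ℕ.^ C)
            z = qᶜ * [ P ≟ᵛ 0ᵛ ]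

            powers : ι q * ι (q ℕ.^ N) ≈ ι (q ℕ.^ L) * ι (q ℕ.^ C)
            powers = begin
              ι q * ι (q ℕ.^ N)            ≈⟨ ι-* q (q ℕ.^ N) ⟨
              ι (q ℕ.^ suc N)              ≈⟨ ι-cong (cong (q ℕ.^_) (≡.sym size)) ⟩
              ι (q ℕ.^ (L ℕ.+ C))          ≈⟨ ι-cong (ℕ.^-distribˡ-+-* q L C) ⟩
              ι (q ℕ.^ L ℕ.* q ℕ.^ C)      ≈⟨ ι-* (q ℕ.^ L) (q ℕ.^ C) ⟩
              ι (q ℕ.^ L) * ι (q ℕ.^ C)    ∎

    ι-q : ι q ≈ 1# + ι (q ℕ.∸ 1)
    ι-q = ι-cong (≡.sym (ℕ.m+[n∸m]≡n {1} {q} (ℕ.>-nonZero⁻¹ q {{q-nonZero}})))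

    κ-trivial : ∀ L C s → (∀ (a : Vec K L) → InKernel C s a → a ≡ 0ᵛ) → ι (κ L C s) ≈ 1#
    κ-trivial L C s trivial = ≈-trans (≈-sym (Σ-[] (inKernel? C s) (vectors k L)))
      (Σ-unique (inKernel? C s) (vectors-unique L) (∈-vectors k 0ᵛ) (kernel-0ᵛ C L s) trivial)

    module _ {p} (m C : ℕ) (m≤C : m ℕ.≤ C) {N : ℕ} {H : Vec K N → Set p} (H? : ∀ x → Dec (H x))
      (H⇒kernel : ∀ x → H x → ∃[ a ] a ≢ 0ᵛ × InKernel C {suc m} (x !_) a)
      (kernel⇒H : ∀ x (a : Vec K (suc m)) → a ≢ 0ᵛ → InKernel C (x !_) a → H x) where

      -- For x ∉ H both kernels are 0; for x ∈ H they differ by the factor q.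

      indicator : ∀ x → ι (q ℕ.∸ 1) * [ H? x ] + ι q * ι (κ m (suc C) (x !_)) + 1# ≈ ι (κ (suc m) C (x !_)) + ι q
      indicator x with H? x
      ... | yes Hx = let a , a≢0 , ka = H⇒kernel x Hx in begin
        ι (q ℕ.∸ 1) * 1# + ι q * ι (κ m (suc C) (x !_)) + 1#
          ≈⟨ solve 2 (λ a b → a :* con 1 :+ b :+ con 1 := b :+ (con 1 :+ a)) ≈-refl _ _ ⟩
        ι q * ι (κ m (suc C) (x !_)) + (1# + ι (q ℕ.∸ 1))
          ≈⟨ +-cong (≈-sym (≈-trans (ι-cong (κ-ratio κ-duality m C (x !_) m≤C a ka a≢0)) (ι-* q _))) (≈-sym ι-q) ⟩
        ι (κ (suc m) C (x !_)) + ι q ∎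
      ... | no ¬Hx = begin
        ι (q ℕ.∸ 1) * 0# + ι q * ι (κ m (suc C) (x !_)) + 1#
          -- A solution in degree m - 1 becomes one in degree m through a factor Y, so the smaller
          -- kernel is 0 as well.
          ≈⟨ +-congʳ (+-congˡ (*-congˡ (κ-trivial m (suc C) (x !_) λ a ka →
               Vec.∷-injectiveʳ (trivial (k.0# ∷ a) (≡.trans (rows-0∷ C a (x !_)) (Vec.∷-injectiveʳ ka)))))) ⟩
        ι (q ℕ.∸ 1) * 0# + ι q * 1# + 1#
          ≈⟨ solve 2 (λ a b → a :* con 0 :+ b :* con 1 :+ con 1 := con 1 :+ b) ≈-refl _ _ ⟩
        1# + ι q
          ≈⟨ +-congʳ (≈-sym (κ-trivial (suc m) C (x !_) trivial)) ⟩
        ι (κ (suc m) C (x !_)) + ι q ∎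
        where
          trivial : ∀ (a : Vec K (suc m)) → InKernel C (x !_) a → a ≡ 0ᵛ
          trivial a ka with a ≟ᵛ 0ᵛ
          ... | yes a≡0 = a≡0
          ... | no  a≢0 = ⊥-elim (¬Hx (kernel⇒H x a a≢0 ka))

      module _ (size : m ℕ.+ C ≡ N) (P : Vec K N)
        {d₁ d₀} {D₁ : Vec K (suc m) → Set d₁} {D₀ : Vec K m → Set d₀}
        (D₁? : ∀ Q → Dec (D₁ Q)) (D₁⇒≢0 : ∀ Q → D₁ Q → Q ≢ 0ᵛ) (D₁⇒factors : ∀ Q → D₁ Q → Factors N C P Q)
        (factors⇒D₁ : ∀ Q → Q ≢ 0ᵛ → Factors N C P Q → D₁ Q)
        (D₀? : ∀ Q → Dec (D₀ Q)) (D₀⇒≢0 : ∀ Q → D₀ Q → Q ≢ 0ᵛ) (D₀⇒factors : ∀ Q → D₀ Q → Factors N (suc C) P Q)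
        (factors⇒D₀ : ∀ Q → Q ≢ 0ᵛ → Factors N (suc C) P Q → D₀ Q) where

        F : R.Carrier
        F = Σ (vectors k N) λ x → [ H? x ] * ψ (dot P (x !_))

        -- The transform of `indicator` with `X-value` inserted twice. For L = m the factor q of
        -- `X-value` is the one that `indicator` puts before the smaller kernel; for L = m + 1 it
        -- cancels against q^(m+1). Hence q^m stands on both sides.
        transform-relation : ι (q ℕ.∸ 1) * F + ι (q ℕ.^ m) * ι (List.length (List.filter D₀? (vectors k m)))
          ≈ ι (q ℕ.^ m) * ι (List.length (List.filter D₁? (vectors k (suc m))))
        -- The added terms are the transforms of the constants q and 1 in `indicator`, one of them
        -- produced by each use of `X-value`.
        transform-relation = R-+-cancelʳ (ι q * Y₁ + Y₁) _ _ (begin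
          (p′ * F + qᵐ * δ₀) + (ι q * Y₁ + Y₁)
            ≈⟨ solve 5 (λ a b c d e → (a :* b :+ c) :+ (d :+ e) := a :* b :+ (d :+ c) :+ e) ≈-refl _ _ _ _ _ ⟩
          p′ * F + (ι q * Y₁ + qᵐ * δ₀) + Y₁
            ≈⟨ +-congʳ (+-congˡ (X-value N m (suc C) size₀ P D₀? D₀⇒≢0 D₀⇒factors factors⇒D₀)) ⟨
          p′ * F + ι q * X₀ + Y₁
            ≈⟨ +-congʳ (+-cong (Σ-*ˡ vs p′ _) (Σ-*ˡ vs (ι q) _)) ⟨
          Σ vs (λ x → p′ * ([ H? x ] * ψ (dot P (x !_)))) + Σ vs (λ x → ι q * (ι (κ m (suc C) (x !_)) * ψ (dot P (x !_)))) + Y₁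
            ≈⟨ ≈-trans (Σ-+ vs _ _) (+-congʳ (Σ-+ vs _ _)) ⟨
          Σ vs (λ x → p′ * ([ H? x ] * ψ (dot P (x !_))) + ι q * (ι (κ m (suc C) (x !_)) * ψ (dot P (x !_))) + ψ (dot P (x !_)))
            ≈⟨ Σ-cong vs (λ x → ≈-trans (factor _ _ _ _ _) (≈-trans (*-congʳ (indicator x)) (R.distribʳ _ _ _))) ⟩
          Σ vs (λ x → ι (κ (suc m) C (x !_)) * ψ (dot P (x !_)) + ι q * ψ (dot P (x !_)))
            ≈⟨ ≈-trans (Σ-+ vs _ _) (+-congˡ (Σ-*ˡ vs (ι q) _)) ⟩
          X₁ + ι q * Y₁
            ≈⟨ +-congʳ X₁-value ⟩
          (Y₁ + qᵐ * δ₁) + ι q * Y₁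
            ≈⟨ solve 3 (λ a b c → (a :+ b) :+ c := b :+ (c :+ a)) ≈-refl _ _ _ ⟩
          qᵐ * δ₁ + (ι q * Y₁ + Y₁) ∎)
          where
            vs : List (Vec K N)
            vs = vectors k N

            size₁ : suc m ℕ.+ C ≡ suc N
            size₁ = cong suc size

            size₀ : m ℕ.+ suc C ≡ suc N
            size₀ = ≡.trans (ℕ.+-suc m C) size₁

            p′ qᵐ δ₀ δ₁ X₀ X₁ Y₁ : R.Carrier
            p′ = ι (q ℕ.∸ 1)
            qᵐ = ι (q ℕ.^ m)
            δ₀ = ι (List.length (List.filter D₀? (vectors k m)))
            δ₁ = ι (List.length (List.filter D₁? (vectors k (suc m))))
            X₀ = X m (suc C) P
            X₁ = X (suc m) C P
            Y₁ = Y P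

            factor : ∀ a b c d e → a * (b * e) + c * (d * e) + e ≈ (a * b + c * d + 1#) * e
            factor = solve 5 (λ a b c d e → a :* (b :* e) :+ c :* (d :* e) :+ e := (a :* b :+ c :* d :+ con 1) :* e) ≈-refl

            X₁-value : X₁ ≈ Y₁ + qᵐ * δ₁
            X₁-value = ι-cancel q q-nonZero _ _ (begin
              ι q * X₁                            ≈⟨ X-value N (suc m) C size₁ P D₁? D₁⇒≢0 D₁⇒factors factors⇒D₁ ⟩
              ι q * Y₁ + ι (q ℕ.* q ℕ.^ m) * δ₁   ≈⟨ +-congˡ (*-congʳ (ι-* q (q ℕ.^ m))) ⟩
              ι q * Y₁ + (ι q * qᵐ) * δ₁          ≈⟨ solve 4 (λ q y p d → q :* y :+ (q :* p) :* d := q :* (y :+ p :* d)) ≈-refl _ _ _ _ ⟩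
              ι q * (Y₁ + qᵐ * δ₁)                ∎)

        -- The value z is described by an equation without denominators; since q - 1 can be
        -- cancelled, this equation determines it.
        transform : (G : Vec K N → R.Carrier) → (∀ x → G x ≡ [ H? x ]) →
          (pairing : Vec K N → K) → (∀ x → pairing x ≡ dot P (x !_)) → ℕ.NonZero (q ℕ.∸ 1) → ∀ z →
          ι (q ℕ.∸ 1) * z + ι (q ℕ.^ m) * ι (List.length (List.filter D₀? (vectors k m)))
            ≈ ι (q ℕ.^ m) * ι (List.length (List.filter D₁? (vectors k (suc m)))) →
          Σ (vectors k N) (λ x → G x * ψ (pairing x)) ≈ z
        transform G G≡ pairing pairing≡ q-1≢0 z eq = ≈-trans
          (Σ-cong (vectors k N) λ x → R.reflexive (cong₂ (λ a b → a * ψ b) (G≡ x) (pairing≡ x)))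
          (ι-cancel (q ℕ.∸ 1) q-1≢0 _ _ (R-+-cancelʳ _ _ _ (≈-trans transform-relation (≈-sym eq))))

open import Data.Integer.Base as ℤ using (ℤ; +_; -[1+_])

-- Divisibility in k[Y,Z] in terms of coefficient vectors.

module Divisibility {c : Level} (k : FiniteField c) where
  open FiniteField k
  open ≡ using (sym; trans)
  open Hankel k
  open CommutativeRing commutativeRing using (+-identityˡ; +-identityʳ)
  open Poly
  open RawMagmaDefinitions (*ᵖ-rawMagma k) using (_∣_; _,_)

  sum-single : ∀ {N} (f : Fin N → Carrier) b → (∀ a → a ≢ b → f a ≡ 0#) → ∑[ a < N ] f a ≡ f b
  sum-single f Fin.zero    others = trans
    (cong (λ t → f Fin.zero + t) (sum-zero k (f ∘ Fin.suc) λ a → others (Fin.suc a) λ ())) (+-identityʳ _)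
  sum-single f (Fin.suc b) others = trans
    (cong₂ _+_ (others Fin.zero λ ()) (sum-single (f ∘ Fin.suc) b λ a a≢b → others (Fin.suc a) (a≢b ∘ Fin.suc-injective)))
    (+-identityˡ _)

  !-beyond : ∀ {N} (v : Vec Carrier N) i → N ℕ.≤ i → v ! i ≡ 0#
  !-beyond []      i       le       = refl
  !-beyond (x ∷ v) (suc i) (s≤s le) = !-beyond v i le

  toPoly-≡ : ∀ {n} (v : V k n) i j → + (i ℕ.+ j) ≡ n → coeff (toPoly k n v) i j ≡ v ! i
  toPoly-≡ {n} v i j eq rewrite dec-true (+ (i ℕ.+ j) ℤ.≟ n) eq = refl

  module _ (d : ℕ) (n e : ℤ) (sum : e ℤ.+ + d ≡ n) (S : V k e) (Q : V k (+ d)) where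

    summand : ∀ i j → Fin (suc i) → Fin (suc j) → Carrier
    summand i j a b = coeff (toPoly k e S) (toℕ a) (toℕ b) * coeff (toPoly k (+ d) Q) (i ℕ.∸ toℕ a) (j ℕ.∸ toℕ b)

    product-coeff-≢ : ∀ i j → + (i ℕ.+ j) ≢ n → coeff (_*ᵖ_ k (toPoly k e S) (toPoly k (+ d) Q)) i j ≡ 0#
    product-coeff-≢ i j i+j≢n = sum-zero k {suc i} _ λ a → sum-zero k (summand i j a) λ b → vanish a b (+ (toℕ a ℕ.+ toℕ b) ℤ.≟ e)
      where
        vanish : ∀ a b → Dec (+ (toℕ a ℕ.+ toℕ b) ≡ e) → summand i j a b ≡ 0#
        vanish a b (no s≢e)   = trans (cong (_* _) (toPoly-≢ k S (toℕ a) (toℕ b) s≢e)) (zeroˡ _)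
        vanish a b (yes refl) = trans (cong (_ *_) (toPoly-≢ k Q (i ℕ.∸ toℕ a) (j ℕ.∸ toℕ b) λ t≡d → i+j≢n (trans
          (cong +_ (sym (complement k (toℕ≤ k a) (toℕ≤ k b)))) (trans (cong (λ t → + (toℕ a ℕ.+ toℕ b) ℤ.+ t) t≡d) sum)))) (zeroʳ _)

    -- By homogeneity of S at most one b contributes for each a, and the degree of the other factor
    -- is then right by itself. If no b ≤ j fits, then either a exceeds the degree of S or i - a
    -- exceeds d, and the term of `conv` vanishes too.
    product-coeff-≡ : ∀ i j → + (i ℕ.+ j) ≡ n → coeff (_*ᵖ_ k (toPoly k e S) (toPoly k (+ d) Q)) i j ≡ conv S Q i
    product-coeff-≡ i j i+j≡n = sum-cong-≗ λ a → inner a (Fin.any? λ b → + (toℕ a ℕ.+ toℕ b) ℤ.≟ e)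
      where
        codegree : ∀ s t → s ℕ.+ t ≡ i ℕ.+ j → + s ≡ e → t ≡ d
        codegree s t s+t refl = ℕ.+-cancelˡ-≡ s t d (trans s+t (ℤ.+-injective (trans i+j≡n (sym sum))))

        inner : ∀ (a : Fin (suc i)) → Dec (∃[ b ] + (toℕ a ℕ.+ toℕ {suc j} b) ≡ e) →
          ∑[ b < suc j ] summand i j a b ≡ S ! toℕ a * Q ! (i ℕ.∸ toℕ a)
        inner a (yes (b , a+b≡e)) = trans (sum-single (summand i j a) b others)
          (cong₂ _*_ (toPoly-≡ S (toℕ a) (toℕ b) a+b≡e)
            (toPoly-≡ Q (i ℕ.∸ toℕ a) (j ℕ.∸ toℕ b) (cong +_ (codegree _ _ (complement k (toℕ≤ k a) (toℕ≤ k b)) a+b≡e))))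
          where
            others : ∀ b′ → b′ ≢ b → summand i j a b′ ≡ 0#
            others b′ b′≢b = trans (cong (_* _) (toPoly-≢ k S (toℕ a) (toℕ b′) λ a+b′≡e →
              b′≢b (Fin.toℕ-injective (ℕ.+-cancelˡ-≡ (toℕ a) _ _ (ℤ.+-injective (trans a+b′≡e (sym a+b≡e))))))) (zeroˡ _)
        inner a (no ¬b) = trans
          (sum-zero k (summand i j a) λ b → trans (cong (_* _) (toPoly-≢ k S (toℕ a) (toℕ b) λ eq → ¬b (b , eq))) (zeroˡ _))
          (sym (vanish (count e ℕ.≤? toℕ a)))
          where
            vanish : Dec (count e ℕ.≤ toℕ a) → S ! toℕ a * Q ! (i ℕ.∸ toℕ a) ≡ 0#
            vanish (yes large) = trans (cong (_* _) (!-beyond S (toℕ a) large)) (zeroˡ _)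
            vanish (no  small) = trans (cong (_ *_) (!-beyond Q (i ℕ.∸ toℕ a) (beyond e refl (ℕ.≰⇒> small)))) (zeroʳ _)
              where
                beyond : ∀ e′ → e ≡ e′ → toℕ a ℕ.< count e′ → suc d ℕ.≤ i ℕ.∸ toℕ a
                beyond (+ e′) e≡e′ (s≤s a≤e′) = ℕ.+-cancelʳ-≤ (toℕ a ℕ.+ j) _ _ (begin
                  suc d ℕ.+ (toℕ a ℕ.+ j)            ≡⟨ ℕ.+-suc d (toℕ a ℕ.+ j) ⟨
                  d ℕ.+ suc (toℕ a ℕ.+ j)            ≤⟨ ℕ.+-monoʳ-≤ d a+j<e′ ⟩
                  d ℕ.+ e′                           ≡⟨ ℕ.+-comm d e′ ⟩
                  e′ ℕ.+ d                           ≡⟨ ℤ.+-injective (trans (cong (ℤ._+ + d) (sym e≡e′)) (trans sum (sym i+j≡n))) ⟩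
                  i ℕ.+ j                            ≡⟨ cong (ℕ._+ j) (ℕ.m∸n+n≡m (toℕ≤ k a)) ⟨
                  i ℕ.∸ toℕ a ℕ.+ toℕ a ℕ.+ j        ≡⟨ ℕ.+-assoc (i ℕ.∸ toℕ a) (toℕ a) j ⟩
                  i ℕ.∸ toℕ a ℕ.+ (toℕ a ℕ.+ j)      ∎)
                  where
                    open ℕ.≤-Reasoning

                    a+j<e′ : toℕ a ℕ.+ j ℕ.< e′
                    a+j<e′ = ℕ.≰⇒> λ e′≤a+j → let e′-a<1+j = s≤s (ℕ.m≤n+o⇒m∸n≤o e′ (toℕ a) e′≤a+j) in
                      ¬b (Fin.fromℕ< e′-a<1+j , trans (cong (λ t → + (toℕ a ℕ.+ t)) (Fin.toℕ-fromℕ< e′-a<1+j))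
                        (trans (cong +_ (ℕ.m+[n∸m]≡n a≤e′)) (sym e≡e′)))

  degree-split : ∀ d n → (n ℤ.- d) ℤ.+ d ≡ n
  degree-split = solve 2 (λ d n → (n :- d) :+ d := n) refl
    where open ℤ-Solver.+-*-Solver

  -- A quotient in k[Y,Z] may be inhomogeneous; its component of degree n - d supplies the form S.
  divides⇒factors : ∀ d n (Q : V k d) (P : V k n) → Q ≢ 0ᵛ → Divides k d n Q P → Factors (count n) (count (n ℤ.- d)) P Q
  divides⇒factors -[1+ _ ] n        [] P Q≢0 _ = ⊥-elim (Q≢0 refl)
  -- P has no coefficients here, so the product is subject to no condition and any S serves.
  divides⇒factors (+ d)    -[1+ _ ] Q  [] Q≢0 _ = 0ᵛ , refl
  divides⇒factors (+ d)    (+ n)    Q  P Q≢0 (R , eq) = S ,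
    trans (prefix-cong (suc n) λ t t<1+n → agree t (ℕ.s≤s⁻¹ t<1+n)) (prefix-! P)
    where
      S : V k (+ n ℤ.- + d)
      S = component k (+ n ℤ.- + d) R

      agree : ∀ t → t ℕ.≤ n → conv S Q t ≡ P ! t
      agree t t≤n = trans (sym (product-coeff-≡ d (+ n) (+ n ℤ.- + d) (degree-split (+ d) (+ n)) S Q t (n ℕ.∸ t) degree))
        (trans (homogenise k (+ d) (+ n) Q P R eq t (n ℕ.∸ t)) (toPoly-≡ P t (n ℕ.∸ t) degree))
        where
          degree : + (t ℕ.+ (n ℕ.∸ t)) ≡ + n
          degree = cong +_ (ℕ.m+[n∸m]≡n t≤n)

  factors⇒divides : ∀ d n (Q : V k d) (P : V k n) → Q ≢ 0ᵛ → Factors (count n) (count (n ℤ.- d)) P Q → Divides k d n Q P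
  factors⇒divides -[1+ _ ] n [] P Q≢0 _ = ⊥-elim (Q≢0 refl)
  factors⇒divides (+ d)    n Q  P Q≢0 (S , eq) = toPoly k (n ℤ.- + d) S , λ i j → agree i j (+ (i ℕ.+ j) ℤ.≟ n)
    where
      agree : ∀ i j → Dec (+ (i ℕ.+ j) ≡ n) →
        coeff (_*ᵖ_ k (toPoly k (n ℤ.- + d) S) (toPoly k (+ d) Q)) i j ≡ coeff (toPoly k n P) i j
      agree i j (yes refl) = trans (product-coeff-≡ d n (n ℤ.- + d) (degree-split (+ d) n) S Q i j refl)
        (trans (prefix-injective (suc (i ℕ.+ j)) {conv S Q} {P !_} (trans eq (sym (prefix-! P))) i (s≤s (ℕ.m≤m+n i j)))
          (sym (toPoly-≡ P i j refl)))
      agree i j (no i+j≢n) = trans (product-coeff-≢ d n (n ℤ.- + d) (degree-split (+ d) n) S Q i j i+j≢n)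
        (sym (toPoly-≢ k P i j i+j≢n))

-- The pairing and the set H in terms of Hankel kernels.

module Characteristic {c : Level} (k : FiniteField c) where
  open FiniteField k
  open Hankel k

  bracket≡dot : ∀ {N} (u v : Vec Carrier N) → ∑[ i < N ] (Vec.lookup u i * Vec.lookup v i) ≡ dot u (v !_)
  bracket≡dot []      []      = refl
  bracket≡dot (x ∷ u) (y ∷ v) = cong (λ t → x * y + t) (bracket≡dot u v)

  sum≡dot : ∀ {N} (a : Vec Carrier N) (s : Stream) → ∑[ i < N ] (Vec.lookup a i * s (toℕ i)) ≡ dot a s
  sum≡dot []      s = refl
  sum≡dot (x ∷ a) s = cong (λ t → x * s 0 + t) (sum≡dot a (s ∘ suc))

  lookup-rows : ∀ C {L} (a : Vec Carrier L) s (j : Fin C) → Vec.lookup (rows C a s) j ≡ dot a (λ i → s (i ℕ.+ toℕ j))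
  lookup-rows (suc C) a s Fin.zero    = dot-cong a λ i → cong s (≡.sym (ℕ.+-identityʳ i))
  lookup-rows (suc C) a s (Fin.suc j) = ≡.trans (lookup-rows C a (s ∘ suc) j)
    (dot-cong a λ i → cong s (≡.sym (ℕ.+-suc i (toℕ j))))

  lookup⇒0ᵛ : ∀ {N} (v : Vec Carrier N) → (∀ i → Vec.lookup v i ≡ 0#) → v ≡ 0ᵛ
  lookup⇒0ᵛ []      eq = refl
  lookup⇒0ᵛ (x ∷ v) eq = cong₂ _∷_ (eq Fin.zero) (lookup⇒0ᵛ v (eq ∘ Fin.suc))

  H⇒kernel : ∀ m n x → H k m n x → ∃[ a ] a ≢ 0ᵛ × InKernel (count (n ℤ.- + m)) {suc m} (x !_) a
  H⇒kernel m n x (a , a≢0 , eqs) = a , a≢0 , lookup⇒0ᵛ _ λ j →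
    ≡.trans (lookup-rows _ a (x !_) j) (≡.trans (≡.sym (sum≡dot a (λ i → x ! (i ℕ.+ toℕ j)))) (eqs j))

  kernel⇒H : ∀ m n x (a : Vec Carrier (suc m)) → a ≢ 0ᵛ → InKernel (count (n ℤ.- + m)) (x !_) a → H k m n x
  kernel⇒H m n x a a≢0 ka = a , a≢0 , λ j → ≡.trans (sum≡dot a (λ i → x ! (i ℕ.+ toℕ j)))
    (≡.trans (≡.sym (lookup-rows _ a (x !_) j)) (≡.trans (cong (λ v → Vec.lookup v j) ka) (Vec.lookup-replicate j 0#)))

-- Real numbers: compatibility with the operations, and zero products.

≈ʳ-pointwise : ∀ x y → (∀ i → seq x i ≡ seq y i) → x ≈ʳ y
≈ʳ-pointwise x y eq ε 0<ε = 0 , λ i _ → subst (λ t → ℚ.∣ t ∣ ℚ.< ε)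
  (≡.sym (≡.trans (cong (ℚ._- seq y i) (eq i)) (ℚ.+-inverseʳ (seq y i)))) 0<ε

≈ʳ-sym : ∀ x y → x ≈ʳ y → y ≈ʳ x
≈ʳ-sym x y x≈y ε 0<ε = let N , close = x≈y ε 0<ε in
  N , λ i N≤i → subst (ℚ._< ε) (∣a-b∣≡∣b-a∣ (seq x i) (seq y i)) (close i N≤i)
  where
    open ℚ-Solver.+-*-Solver

    ∣a-b∣≡∣b-a∣ : ∀ a b → ℚ.∣ a ℚ.- b ∣ ≡ ℚ.∣ b ℚ.- a ∣
    ∣a-b∣≡∣b-a∣ a b = ≡.trans (≡.sym (ℚ.∣-p∣≡∣p∣ (a ℚ.- b)))
      (cong ℚ.∣_∣ (solve 2 (λ a b → :- (a :- b) := b :- a) refl a b))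

eventually₂ : {P Q S : ℕ → Set} → (∀ i → P i → Q i → S i) →
  (∃[ N ] ∀ i → N ℕ.≤ i → P i) → (∃[ N ] ∀ i → N ℕ.≤ i → Q i) → ∃[ N ] ∀ i → N ℕ.≤ i → S i
eventually₂ f (M , p) (N , q) = M ℕ.⊔ N , λ i le →
  f i (p i (ℕ.m⊔n≤o⇒m≤o M N le)) (q i (ℕ.m⊔n≤o⇒n≤o M N le))

≈ʳ-trans : ∀ x y z → x ≈ʳ y → y ≈ʳ z → x ≈ʳ z
≈ʳ-trans x y z x≈y y≈z ε 0<ε = eventually₂
  (λ i xy yz → subst (λ t → ℚ.∣ t ∣ ℚ.< ε) (telescope (seq x i) (seq y i) (seq z i))
    (+-estimate (seq x i) (seq y i) (seq y i) (seq z i) ε xy yz))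
  (x≈y (½ ℚ.* ε) (halve ε 0<ε)) (y≈z (½ ℚ.* ε) (halve ε 0<ε))
  where
    open ℚ-Solver.+-*-Solver

    telescope : ∀ a b c → (a ℚ.+ b) ℚ.- (b ℚ.+ c) ≡ a ℚ.- c
    telescope = solve 3 (λ a b c → (a :+ b) :- (b :+ c) := a :- c) refl

+ʳ-cong : ∀ x x′ y y′ → x ≈ʳ x′ → y ≈ʳ y′ → x +ʳ y ≈ʳ x′ +ʳ y′
+ʳ-cong x x′ y y′ x≈x′ y≈y′ ε 0<ε = eventually₂
  (λ i → +-estimate (seq x i) (seq y i) (seq x′ i) (seq y′ i) ε)
  (x≈x′ (½ ℚ.* ε) (halve ε 0<ε)) (y≈y′ (½ ℚ.* ε) (halve ε 0<ε))

-ʳ-cong : ∀ x y → x ≈ʳ y → -ʳ x ≈ʳ -ʳ y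
-ʳ-cong x y x≈y ε 0<ε = let N , close = x≈y ε 0<ε in
  N , λ i N≤i → subst (ℚ._< ε)
    (≡.trans (≡.sym (ℚ.∣-p∣≡∣p∣ (seq x i ℚ.- seq y i))) (cong ℚ.∣_∣ (neg-identity (seq x i) (seq y i)))) (close i N≤i)

*ʳ-cong : ∀ x x′ y y′ → x ≈ʳ x′ → y ≈ʳ y′ → x *ʳ y ≈ʳ x′ *ʳ y′
*ʳ-cong x x′ y y′ x≈x′ y≈y′ ε 0<ε =
  let A , M , 0<A , x≤A  = eventuallyBounded x
      D , N , 0<D , y′≤D = eventuallyBounded y′
      δ , 0<δ , total    = split A D ε 0<A 0<D 0<ε
  in eventually₂ (λ i (a≤A , d≤D) (ac , bd) →
       *-estimate (seq x i) (seq y i) (seq x′ i) (seq y′ i) A D δ ε total 0<A 0<D a≤A d≤D ac bd)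
     (eventually₂ (λ _ → _,_) (M , x≤A) (N , y′≤D))
     (eventually₂ (λ _ → _,_) (x≈x′ δ 0<δ) (y≈y′ δ 0<δ))

0ʳ : ℝ
0ʳ = ℚ⇒ℝ 0ℚ

≈0-bound : ∀ x ε → (∃[ N ] ∀ i → N ℕ.≤ i → ℚ.∣ seq x i ∣ ℚ.< ε) → ∃[ N ] ∀ i → N ℕ.≤ i → ℚ.∣ seq x i ℚ.- 0ℚ ∣ ℚ.< ε
≈0-bound x ε (N , small) = N , λ i N≤i → subst (λ t → ℚ.∣ t ∣ ℚ.< ε) (≡.sym (ℚ.+-identityʳ (seq x i))) (small i N≤i)

bound-≈0 : ∀ x ε → 0ℚ ℚ.< ε → x ≈ʳ 0ʳ → ∃[ N ] ∀ i → N ℕ.≤ i → ℚ.∣ seq x i ∣ ℚ.< ε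
bound-≈0 x ε 0<ε x≈0 = let N , small = x≈0 ε 0<ε in
  N , λ i N≤i → subst (λ t → ℚ.∣ t ∣ ℚ.< ε) (ℚ.+-identityʳ (seq x i)) (small i N≤i)

-- For every ε, ∣ y ∣ is eventually < ε or eventually > ε / 4, and in the second
-- case x * y ≈ 0 would force x ≈ 0.

zero-product : ∀ x y → ¬ (x ≈ʳ 0ʳ) → x *ʳ y ≈ʳ 0ʳ → y ≈ʳ 0ʳ
zero-product x y x≉0 xy≈0 ε 0<ε = ≈0-bound y ε (by-size (cauchy y η 0<η))
  where
    open ℚ.≤-Reasoning

    δ η : ℚ
    δ = ½ ℚ.* ε
    η = ½ ℚ.* δ

    0<δ : 0ℚ ℚ.< δ
    0<δ = halve ε 0<ε

    0<η : 0ℚ ℚ.< η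
    0<η = halve δ 0<δ

    η<δ : η ℚ.< δ
    η<δ = begin-strict
      η            ≡⟨ ℚ.+-identityʳ η ⟨
      η ℚ.+ 0ℚ     <⟨ ℚ.+-monoʳ-< η 0<η ⟩
      η ℚ.+ η      ≡⟨ halves δ ⟩
      δ            ∎

    triangle : ∀ a b → ℚ.∣ a ∣ ℚ.≤ ℚ.∣ a ℚ.- b ∣ ℚ.+ ℚ.∣ b ∣
    triangle a b = begin
      ℚ.∣ a ∣                        ≡⟨ cong ℚ.∣_∣ (cancel-identity a b) ⟨
      ℚ.∣ (a ℚ.- b) ℚ.+ b ∣          ≤⟨ ℚ.∣p+q∣≤∣p∣+∣q∣ (a ℚ.- b) b ⟩
      ℚ.∣ a ℚ.- b ∣ ℚ.+ ℚ.∣ b ∣      ∎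

    by-size : (∃[ N ] ∀ i j → N ℕ.≤ i → N ℕ.≤ j → ℚ.∣ seq y i ℚ.- seq y j ∣ ℚ.< η) →
      ∃[ N ] ∀ i → N ℕ.≤ i → ℚ.∣ seq y i ∣ ℚ.< ε
    by-size (N , close) with ℚ.∣ seq y N ∣ ℚ.<? δ
    ... | yes small = N , λ i N≤i → begin-strict
      ℚ.∣ seq y i ∣                                      ≤⟨ triangle (seq y i) (seq y N) ⟩
      ℚ.∣ seq y i ℚ.- seq y N ∣ ℚ.+ ℚ.∣ seq y N ∣        <⟨ ℚ.+-mono-< (ℚ.<-trans (close i N N≤i ℕ.≤-refl) η<δ) small ⟩
      δ ℚ.+ δ                                            ≡⟨ halves ε ⟩
      ε                                                  ∎
    ... | no large = ⊥-elim (x≉0 λ ε′ 0<ε′ → ≈0-bound x ε′ (eventually₂ (shrink ε′)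
        (bound-≈0 (x *ʳ y) (ε′ ℚ.* η) (ℚ.positive⁻¹ (ε′ ℚ.* η) {{ℚ.pos*pos⇒pos ε′ {{ℚ.positive 0<ε′}} η {{ℚ.positive 0<η}}}}) xy≈0)
        (N , away)))
      where
        away : ∀ i → N ℕ.≤ i → η ℚ.< ℚ.∣ seq y i ∣
        away i N≤i = ℚ.≰⇒> λ y≤η → ℚ.<-irrefl refl (begin-strict
          δ                                                ≤⟨ ℚ.≮⇒≥ large ⟩
          ℚ.∣ seq y N ∣                                    ≤⟨ triangle (seq y N) (seq y i) ⟩
          ℚ.∣ seq y N ℚ.- seq y i ∣ ℚ.+ ℚ.∣ seq y i ∣      <⟨ ℚ.+-mono-<-≤ (close N i ℕ.≤-refl N≤i) y≤η ⟩
          η ℚ.+ η                                          ≡⟨ halves δ ⟩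
          δ                                                ∎)

        shrink : ∀ ε′ i → ℚ.∣ seq x i ℚ.* seq y i ∣ ℚ.< ε′ ℚ.* η → η ℚ.< ℚ.∣ seq y i ∣ → ℚ.∣ seq x i ∣ ℚ.< ε′
        shrink ε′ i xy<ε′η η<y = ℚ.*-cancelʳ-<-nonNeg η {{ℚ.nonNegative (ℚ.<⇒≤ 0<η)}} (begin-strict
          ℚ.∣ seq x i ∣ ℚ.* η                   ≤⟨ ℚ.*-monoˡ-≤-nonNeg ℚ.∣ seq x i ∣ {{ℚ.∣-∣-nonNeg (seq x i)}} (ℚ.<⇒≤ η<y) ⟩
          ℚ.∣ seq x i ∣ ℚ.* ℚ.∣ seq y i ∣       ≡⟨ ℚ.∣p*q∣≡∣p∣*∣q∣ (seq x i) (seq y i) ⟨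
          ℚ.∣ seq x i ℚ.* seq y i ∣             <⟨ xy<ε′η ⟩
          ε′ ℚ.* η                              ∎)

0≤square : ∀ p → 0ℚ ℚ.≤ p ℚ.* p
0≤square p with ℚ.≤-total 0ℚ p
... | inj₁ 0≤p = subst (ℚ._≤ p ℚ.* p) (ℚ.*-zeroˡ p) (ℚ.*-monoʳ-≤-nonNeg p {{ℚ.nonNegative 0≤p}} 0≤p)
... | inj₂ p≤0 = subst (ℚ._≤ p ℚ.* p) (ℚ.*-zeroˡ p) (ℚ.*-monoʳ-≤-nonPos p {{ℚ.nonPositive p≤0}} p≤0)

∣square∣ : ∀ p → ℚ.∣ p ∣ ℚ.* ℚ.∣ p ∣ ≡ p ℚ.* p
∣square∣ p = ≡.trans (≡.sym (ℚ.∣p*q∣≡∣p∣*∣q∣ p p)) (ℚ.0≤p⇒∣p∣≡p (0≤square p))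

-- Since b² ≥ 0, a bound ε² for a² + b² forces |a| < ε. This passes from |t|² ≈ 0 to t ≈ 0 for
-- complex t.
sum-of-squares : ∀ x y → x *ʳ x +ʳ y *ʳ y ≈ʳ 0ʳ → x ≈ʳ 0ʳ
sum-of-squares x y eq ε 0<ε = ≈0-bound x ε
  (let N , small = bound-≈0 (x *ʳ x +ʳ y *ʳ y) (ε ℚ.* ε) (ℚ.positive⁻¹ (ε ℚ.* ε) {{ℚ.pos*pos⇒pos ε {{ε-pos}} ε {{ε-pos}}}}) eq
   in N , λ i N≤i → root (seq x i) (seq y i) (small i N≤i))
  where
    open ℚ.≤-Reasoning

    ε-pos : ℚ.Positive ε
    ε-pos = ℚ.positive 0<ε

    root : ∀ a b → ℚ.∣ a ℚ.* a ℚ.+ b ℚ.* b ∣ ℚ.< ε ℚ.* ε → ℚ.∣ a ∣ ℚ.< ε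
    root a b small = ℚ.≰⇒> λ ε≤a → ℚ.<-irrefl refl (begin-strict
      ε ℚ.* ε                            ≤⟨ ℚ.*-monoʳ-≤-nonNeg ε {{ℚ.nonNegative (ℚ.<⇒≤ 0<ε)}} ε≤a ⟩
      ℚ.∣ a ∣ ℚ.* ε                      ≤⟨ ℚ.*-monoˡ-≤-nonNeg ℚ.∣ a ∣ {{ℚ.∣-∣-nonNeg a}} ε≤a ⟩
      ℚ.∣ a ∣ ℚ.* ℚ.∣ a ∣                ≡⟨ ∣square∣ a ⟩
      a ℚ.* a                            ≡⟨ ℚ.+-identityʳ (a ℚ.* a) ⟨
      a ℚ.* a ℚ.+ 0ℚ                     ≤⟨ ℚ.+-monoʳ-≤ (a ℚ.* a) (0≤square b) ⟩
      a ℚ.* a ℚ.+ b ℚ.* b                ≡⟨ ℚ.0≤p⇒∣p∣≡p (ℚ.+-mono-≤ (0≤square a) (0≤square b)) ⟨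
      ℚ.∣ a ℚ.* a ℚ.+ b ℚ.* b ∣          <⟨ small ⟩
      ε ℚ.* ε                            ∎)

-- The ring of complex numbers.

≈ᶜ-pointwise : ∀ z w → (∀ i → seq (re z) i ≡ seq (re w) i) → (∀ i → seq (im z) i ≡ seq (im w) i) → z ≈ᶜ w
≈ᶜ-pointwise z w eq eq′ = ≈ʳ-pointwise (re z) (re w) eq , ≈ʳ-pointwise (im z) (im w) eq′

≈ᶜ-sym : ∀ z w → z ≈ᶜ w → w ≈ᶜ z
≈ᶜ-sym z w (eq , eq′) = ≈ʳ-sym (re z) (re w) eq , ≈ʳ-sym (im z) (im w) eq′

≈ᶜ-trans : ∀ z w v → z ≈ᶜ w → w ≈ᶜ v → z ≈ᶜ v
≈ᶜ-trans z w v (p , p′) (q , q′) = ≈ʳ-trans (re z) (re w) (re v) p q , ≈ʳ-trans (im z) (im w) (im v) p′ q′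

-ᶜ_ : ℂ → ℂ
-ᶜ z = (-ʳ re z) +i (-ʳ im z)

+ᶜ-cong : ∀ z z′ w w′ → z ≈ᶜ z′ → w ≈ᶜ w′ → z +ᶜ w ≈ᶜ z′ +ᶜ w′
+ᶜ-cong z z′ w w′ (p , p′) (q , q′) =
  +ʳ-cong (re z) (re z′) (re w) (re w′) p q , +ʳ-cong (im z) (im z′) (im w) (im w′) p′ q′

*ᶜ-cong : ∀ z z′ w w′ → z ≈ᶜ z′ → w ≈ᶜ w′ → z *ᶜ w ≈ᶜ z′ *ᶜ w′
*ᶜ-cong z z′ w w′ (p , p′) (q , q′) =
  +ʳ-cong (re z *ʳ re w) (re z′ *ʳ re w′) (-ʳ (im z *ʳ im w)) (-ʳ (im z′ *ʳ im w′))
    (*ʳ-cong (re z) (re z′) (re w) (re w′) p q)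
    (-ʳ-cong (im z *ʳ im w) (im z′ *ʳ im w′) (*ʳ-cong (im z) (im z′) (im w) (im w′) p′ q′)) ,
  +ʳ-cong (re z *ʳ im w) (re z′ *ʳ im w′) (im z *ʳ re w) (im z′ *ʳ re w′)
    (*ʳ-cong (re z) (re z′) (im w) (im w′) p q′) (*ʳ-cong (im z) (im z′) (re w) (re w′) p′ q)

ℂ-commutativeRing : CommutativeRing 0ℓ 0ℓ
ℂ-commutativeRing = record
  { Carrier = ℂ
  ; _≈_ = _≈ᶜ_
  ; _+_ = _+ᶜ_
  ; _*_ = _*ᶜ_
  ; -_ = -ᶜ_
  ; 0# = 0ᶜ
  ; 1# = 1ᶜ
  ; isCommutativeRing = record
    { isRing = record
      { +-isAbelianGroup = record
        { isGroup = record
          { isMonoid = record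
            { isSemigroup = record
              { isMagma = record
                { isEquivalence = record
                  { refl  = λ {z} → ≈ᶜ-pointwise z z (λ _ → refl) (λ _ → refl)
                  ; sym   = λ {z w} → ≈ᶜ-sym z w
                  ; trans = λ {z w v} → ≈ᶜ-trans z w v
                  }
                ; ∙-cong = λ {z z′ w w′} → +ᶜ-cong z z′ w w′
                }
              ; assoc = λ z w v → ≈ᶜ-pointwise ((z +ᶜ w) +ᶜ v) (z +ᶜ (w +ᶜ v))
                  (λ i → ℚ.+-assoc (seq (re z) i) (seq (re w) i) (seq (re v) i))
                  (λ i → ℚ.+-assoc (seq (im z) i) (seq (im w) i) (seq (im v) i))
              }
            ; identity =
                (λ z → ≈ᶜ-pointwise (0ᶜ +ᶜ z) z (λ i → ℚ.+-identityˡ (seq (re z) i)) (λ i → ℚ.+-identityˡ (seq (im z) i))) ,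
                (λ z → ≈ᶜ-pointwise (z +ᶜ 0ᶜ) z (λ i → ℚ.+-identityʳ (seq (re z) i)) (λ i → ℚ.+-identityʳ (seq (im z) i)))
            }
          ; inverse =
              (λ z → ≈ᶜ-pointwise ((-ᶜ z) +ᶜ z) 0ᶜ (λ i → ℚ.+-inverseˡ (seq (re z) i)) (λ i → ℚ.+-inverseˡ (seq (im z) i))) ,
              (λ z → ≈ᶜ-pointwise (z +ᶜ (-ᶜ z)) 0ᶜ (λ i → ℚ.+-inverseʳ (seq (re z) i)) (λ i → ℚ.+-inverseʳ (seq (im z) i)))
          ; ⁻¹-cong = λ {z w} (p , p′) → -ʳ-cong (re z) (re w) p , -ʳ-cong (im z) (im w) p′
          }
        ; comm = λ z w → ≈ᶜ-pointwise (z +ᶜ w) (w +ᶜ z)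
            (λ i → ℚ.+-comm (seq (re z) i) (seq (re w) i)) (λ i → ℚ.+-comm (seq (im z) i) (seq (im w) i))
        }
      ; *-cong = λ {z z′ w w′} → *ᶜ-cong z z′ w w′
      ; *-assoc = λ z w v → ≈ᶜ-pointwise ((z *ᶜ w) *ᶜ v) (z *ᶜ (w *ᶜ v))
          (λ i → assoc-re (seq (re z) i) (seq (im z) i) (seq (re w) i) (seq (im w) i) (seq (re v) i) (seq (im v) i))
          (λ i → assoc-im (seq (re z) i) (seq (im z) i) (seq (re w) i) (seq (im w) i) (seq (re v) i) (seq (im v) i))
      ; *-identity =
          (λ z → ≈ᶜ-pointwise (1ᶜ *ᶜ z) z (λ i → 1-re (seq (re z) i) (seq (im z) i)) (λ i → 1-im (seq (re z) i) (seq (im z) i))) ,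
          (λ z → ≈ᶜ-pointwise (z *ᶜ 1ᶜ) z (λ i → re-1 (seq (re z) i) (seq (im z) i)) (λ i → im-1 (seq (re z) i) (seq (im z) i)))
      ; distrib =
          (λ z w v → ≈ᶜ-pointwise (z *ᶜ (w +ᶜ v)) (z *ᶜ w +ᶜ z *ᶜ v)
            (λ i → distribˡ-re (seq (re z) i) (seq (im z) i) (seq (re w) i) (seq (im w) i) (seq (re v) i) (seq (im v) i))
            (λ i → distribˡ-im (seq (re z) i) (seq (im z) i) (seq (re w) i) (seq (im w) i) (seq (re v) i) (seq (im v) i))) ,
          (λ z w v → ≈ᶜ-pointwise ((w +ᶜ v) *ᶜ z) (w *ᶜ z +ᶜ v *ᶜ z)
            (λ i → distribʳ-re (seq (re z) i) (seq (im z) i) (seq (re w) i) (seq (im w) i) (seq (re v) i) (seq (im v) i))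
            (λ i → distribʳ-im (seq (re z) i) (seq (im z) i) (seq (re w) i) (seq (im w) i) (seq (re v) i) (seq (im v) i)))
      }
    ; *-comm = λ z w → ≈ᶜ-pointwise (z *ᶜ w) (w *ᶜ z)
        (λ i → comm-re (seq (re z) i) (seq (im z) i) (seq (re w) i) (seq (im w) i))
        (λ i → comm-im (seq (re z) i) (seq (im z) i) (seq (re w) i) (seq (im w) i))
    }
  }
  where
    open ℚ-Solver.+-*-Solver

    Re Im : ∀ {n} (a b c d : Polynomial n) → Polynomial n
    Re a b c d = a :* c :+ :- (b :* d)
    Im a b c d = a :* d :+ b :* c

    assoc-re = solve 6 (λ a b c d e f → Re (Re a b c d) (Im a b c d) e f := Re a b (Re c d e f) (Im c d e f)) refl
    assoc-im = solve 6 (λ a b c d e f → Im (Re a b c d) (Im a b c d) e f := Im a b (Re c d e f) (Im c d e f)) refl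
    1-re = solve 2 (λ a b → Re (con 1ℚ) (con 0ℚ) a b := a) refl
    1-im = solve 2 (λ a b → Im (con 1ℚ) (con 0ℚ) a b := b) refl
    re-1 = solve 2 (λ a b → Re a b (con 1ℚ) (con 0ℚ) := a) refl
    im-1 = solve 2 (λ a b → Im a b (con 1ℚ) (con 0ℚ) := b) refl
    distribˡ-re = solve 6 (λ a b c d e f → Re a b (c :+ e) (d :+ f) := Re a b c d :+ Re a b e f) refl
    distribˡ-im = solve 6 (λ a b c d e f → Im a b (c :+ e) (d :+ f) := Im a b c d :+ Im a b e f) refl
    distribʳ-re = solve 6 (λ a b c d e f → Re (c :+ e) (d :+ f) a b := Re c d a b :+ Re e f a b) refl
    distribʳ-im = solve 6 (λ a b c d e f → Im (c :+ e) (d :+ f) a b := Im c d a b :+ Im e f a b) refl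
    comm-re = solve 4 (λ a b c d → Re a b c d := Re c d a b) refl
    comm-im = solve 4 (λ a b c d → Im a b c d := Im c d a b) refl

-- Cancelling complex factors.

module RingLemmas (R : CommutativeRing 0ℓ 0ℓ) where
  open CommutativeRing R renaming (refl to ≈-refl; sym to ≈-sym; trans to ≈-trans; setoid to ≈-setoid)
  open RingProperties ring using (+-cancelʳ; -1*x≈-x)
  open SetoidReasoning ≈-setoid

  unit-cancel : ∀ y c u v → y * c ≈ 1# → c * u ≈ c * v → u ≈ v
  unit-cancel y c u v yc≈1 cu≈cv = begin
    u             ≈⟨ *-identityˡ u ⟨
    1# * u        ≈⟨ *-congʳ yc≈1 ⟨
    (y * c) * u   ≈⟨ *-assoc y c u ⟩
    y * (c * u)   ≈⟨ *-congˡ cu≈cv ⟩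
    y * (c * v)   ≈⟨ *-assoc y c v ⟨
    (y * c) * v   ≈⟨ *-congʳ yc≈1 ⟩
    1# * v        ≈⟨ *-identityˡ v ⟩
    v             ∎

  idempotent-unit : ∀ y c → y * c ≈ 1# → c ≈ c * c → c ≈ 1#
  idempotent-unit y c yc≈1 c≈cc = unit-cancel y c c 1# yc≈1 (≈-trans (≈-sym c≈cc) (≈-sym (*-identityʳ c)))

  fixed⇒annihilated : ∀ y x z → x * z ≈ z → y * ((x + - 1#) * z) ≈ 0#
  fixed⇒annihilated y x z xz≈z = begin
    y * ((x + - 1#) * z)        ≈⟨ *-congˡ (distribʳ z x (- 1#)) ⟩
    y * (x * z + - 1# * z)      ≈⟨ *-congˡ (+-cong xz≈z (-1*x≈-x z)) ⟩
    y * (z + - z)               ≈⟨ *-congˡ (-‿inverseʳ z) ⟩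
    y * 0#                      ≈⟨ zeroʳ y ⟩
    0#                          ∎

  -1-cancel : ∀ x → x + - 1# ≈ 0# → x ≈ 1#
  -1-cancel x eq = +-cancelʳ (- 1#) x 1# (≈-trans eq (≈-sym (-‿inverseʳ 1#)))

open RingLemmas ℂ-commutativeRing
open Summation ℂ-commutativeRing using (ι)

conj : ℂ → ℂ
conj z = re z +i (-ʳ im z)

module _ where
  open ℚ-Solver.+-*-Solver

  conj-unit : ∀ z → OnUnitCircle z → conj z *ᶜ z ≈ᶜ 1ᶜ
  conj-unit z unit =
    ≈ʳ-trans (re (conj z *ᶜ z)) (re z *ʳ re z +ʳ im z *ʳ im z) (ℚ⇒ℝ 1ℚ)
      (≈ʳ-pointwise (re (conj z *ᶜ z)) (re z *ʳ re z +ʳ im z *ʳ im z) λ i → norm (seq (re z) i) (seq (im z) i)) unit ,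
    ≈ʳ-pointwise (im (conj z *ᶜ z)) 0ʳ λ i → imaginary (seq (re z) i) (seq (im z) i)
    where
      norm : ∀ a b → a ℚ.* a ℚ.+ ℚ.- (ℚ.- b ℚ.* b) ≡ a ℚ.* a ℚ.+ b ℚ.* b
      norm = solve 2 (λ a b → a :* a :+ :- (:- b :* b) := a :* a :+ b :* b) refl

      imaginary : ∀ a b → a ℚ.* b ℚ.+ ℚ.- b ℚ.* a ≡ 0ℚ
      imaginary = solve 2 (λ a b → a :* b :+ :- b :* a := con 0ℚ) refl

  norm² : ℂ → ℝ
  norm² z = re z *ʳ re z +ʳ im z *ʳ im z

  norm²≈0 : ∀ z → norm² z ≈ʳ 0ʳ → z ≈ᶜ 0ᶜ
  norm²≈0 z eq = sum-of-squares (re z) (im z) eq , sum-of-squares (im z) (re z)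
    (≈ʳ-trans (im z *ʳ im z +ʳ re z *ʳ re z) (norm² z) 0ʳ
      (≈ʳ-pointwise (im z *ʳ im z +ʳ re z *ʳ re z) (norm² z)
        λ i → ℚ.+-comm (seq (im z) i ℚ.* seq (im z) i) (seq (re z) i ℚ.* seq (re z) i)) eq)

  -- With t = x - 1 one has t z ≈ 0, and multiplying by the conjugate of t gives |t|² z ≈ 0. The
  -- factor is now real and not 0, so `zero-product` applies to the real and imaginary parts of z
  -- separately; no inverse of t is formed.
  fixed⇒0 : ∀ x z → ¬ (x ≈ᶜ 1ᶜ) → x *ᶜ z ≈ᶜ z → z ≈ᶜ 0ᶜ
  fixed⇒0 x z x≉1 xz≈z =
    zero-product (norm² t) (re z) t≉0
      (≈ʳ-trans (norm² t *ʳ re z) (re (conj t *ᶜ (t *ᶜ z))) 0ʳ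
        (≈ʳ-pointwise (norm² t *ʳ re z) (re (conj t *ᶜ (t *ᶜ z))) λ i →
          real (seq (re t) i) (seq (im t) i) (seq (re z) i) (seq (im z) i)) (proj₁ annihilated)) ,
    zero-product (norm² t) (im z) t≉0
      (≈ʳ-trans (norm² t *ʳ im z) (im (conj t *ᶜ (t *ᶜ z))) 0ʳ
        (≈ʳ-pointwise (norm² t *ʳ im z) (im (conj t *ᶜ (t *ᶜ z))) λ i →
          imaginary (seq (re t) i) (seq (im t) i) (seq (re z) i) (seq (im z) i)) (proj₂ annihilated))
    where
      t : ℂ
      t = x +ᶜ (-ᶜ 1ᶜ)

      t≉0 : ¬ (norm² t ≈ʳ 0ʳ)
      t≉0 eq = x≉1 (-1-cancel x (norm²≈0 t eq))

      annihilated : conj t *ᶜ (t *ᶜ z) ≈ᶜ 0ᶜ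
      annihilated = fixed⇒annihilated (conj t) x z xz≈z

      real : ∀ u v a b → (u ℚ.* u ℚ.+ v ℚ.* v) ℚ.* a
        ≡ u ℚ.* (u ℚ.* a ℚ.+ ℚ.- (v ℚ.* b)) ℚ.+ ℚ.- (ℚ.- v ℚ.* (u ℚ.* b ℚ.+ v ℚ.* a))
      real = solve 4 (λ u v a b → (u :* u :+ v :* v) :* a
        := u :* (u :* a :+ :- (v :* b)) :+ :- (:- v :* (u :* b :+ v :* a))) refl

      imaginary : ∀ u v a b → (u ℚ.* u ℚ.+ v ℚ.* v) ℚ.* b
        ≡ u ℚ.* (u ℚ.* b ℚ.+ v ℚ.* a) ℚ.+ ℚ.- v ℚ.* (u ℚ.* a ℚ.+ ℚ.- (v ℚ.* b))
      imaginary = solve 4 (λ u v a b → (u :* u :+ v :* v) :* b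
        := u :* (u :* b :+ v :* a) :+ :- v :* (u :* a :+ :- (v :* b))) refl

-- Natural and rational numbers inside the complex numbers.

suc/1 : ∀ n → + suc n ℚ./ 1 ≡ 1ℚ ℚ.+ + n ℚ./ 1
suc/1 n = ℚ.toℚᵘ-injective (begin
  ℚ.toℚᵘ (+ suc n ℚ./ 1)               ≈⟨ ℚ.toℚᵘ-fromℚᵘ (+ suc n ℚᵘ./ 1) ⟩
  + suc n ℚᵘ./ 1                       ≈⟨ ℚᵘ.*≡* (cong (λ t → (+ 1 ℤ.+ t) ℤ.* + 1) (≡.sym (ℤ.*-identityʳ (+ n)))) ⟩
  ℚᵘ.1ℚᵘ ℚᵘ.+ (+ n ℚᵘ./ 1)             ≈⟨ ℚᵘ.+-congʳ ℚᵘ.1ℚᵘ (ℚ.toℚᵘ-fromℚᵘ (+ n ℚᵘ./ 1)) ⟨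
  ℚᵘ.1ℚᵘ ℚᵘ.+ ℚ.toℚᵘ (+ n ℚ./ 1)       ≈⟨ ℚ.toℚᵘ-homo-+ 1ℚ (+ n ℚ./ 1) ⟨
  ℚ.toℚᵘ (1ℚ ℚ.+ + n ℚ./ 1)            ∎)
  where open SetoidReasoning ℚᵘ.≃-setoid

*-/ : ∀ p x .{{_ : ℕ.NonZero p}} → (+ p ℚ./ 1) ℚ.* (+ x ℚ./ p) ≡ + x ℚ./ 1
*-/ p@(suc _) x = ℚ.toℚᵘ-injective (begin
  ℚ.toℚᵘ ((+ p ℚ./ 1) ℚ.* (+ x ℚ./ p))                ≈⟨ ℚ.toℚᵘ-homo-* (+ p ℚ./ 1) (+ x ℚ./ p) ⟩
  ℚ.toℚᵘ (+ p ℚ./ 1) ℚᵘ.* ℚ.toℚᵘ (+ x ℚ./ p)          ≈⟨ ℚᵘ.*-cong (ℚ.toℚᵘ-fromℚᵘ (+ p ℚᵘ./ 1)) (ℚ.toℚᵘ-fromℚᵘ (+ x ℚᵘ./ p)) ⟩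
  (+ p ℚᵘ./ 1) ℚᵘ.* (+ x ℚᵘ./ p)                      ≈⟨ ℚᵘ.*≡* cross ⟩
  + x ℚᵘ./ 1                                          ≈⟨ ℚ.toℚᵘ-fromℚᵘ (+ x ℚᵘ./ 1) ⟨
  ℚ.toℚᵘ (+ x ℚ./ 1)                                  ∎)
  where
    open SetoidReasoning ℚᵘ.≃-setoid

    cross : (+ p ℤ.* + x) ℤ.* + 1 ≡ + x ℤ.* (+ 1 ℤ.* + p)
    cross = ≡.trans (ℤ.*-identityʳ (+ p ℤ.* + x)) (≡.trans (ℤ.*-comm (+ p) (+ x))
      (cong (+ x ℤ.*_) (≡.sym (ℤ.*-identityˡ (+ p)))))

/1-injective : ∀ a b → + a ℚ./ 1 ≡ + b ℚ./ 1 → a ≡ b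
/1-injective a b eq = ≡.trans (≡.sym (ℕ.*-identityʳ a)) (≡.trans (ℤ.+-injective (begin
  + (a ℕ.* 1)             ≡⟨ ℤ.pos-* a 1 ⟩
  + a ℤ.* + 1             ≡⟨ ℚᵘ.drop-*≡* same ⟩
  + b ℤ.* + 1             ≡⟨ ℤ.pos-* b 1 ⟨
  + (b ℕ.* 1)             ∎)) (ℕ.*-identityʳ b))
  where
    open ≡.≡-Reasoning

    same : (+ a ℚᵘ./ 1) ℚᵘ.≃ (+ b ℚᵘ./ 1)
    same = ℚᵘ.≃-trans (ℚᵘ.≃-sym (ℚ.toℚᵘ-fromℚᵘ (+ a ℚᵘ./ 1)))
      (ℚᵘ.≃-trans (ℚᵘ.≃-reflexive (cong ℚ.toℚᵘ eq)) (ℚ.toℚᵘ-fromℚᵘ (+ b ℚᵘ./ 1)))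

ι-re : ∀ n i → seq (re (ι n)) i ≡ + n ℚ./ 1
ι-re zero    i = refl
ι-re (suc n) i = ≡.trans (cong (1ℚ ℚ.+_) (ι-re n i)) (≡.sym (suc/1 n))

ι-im : ∀ n i → seq (im (ι n)) i ≡ 0ℚ
ι-im zero    i = refl
ι-im (suc n) i = cong (0ℚ ℚ.+_) (ι-im n i)

ι-injectiveᶜ : ∀ a b → ι a ≈ᶜ ι b → a ≡ b
ι-injectiveᶜ a b (eq , _) with + a ℚ./ 1 ℚ.≟ + b ℚ./ 1
... | yes a≡b = /1-injective a b a≡b
... | no  a≢b = ⊥-elim (ℚ.<-irrefl refl (subst₂ (λ s t → ℚ.∣ s ℚ.- t ∣ ℚ.< ε) (ι-re a N) (ι-re b N) (close N ℕ.≤-refl)))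
  where
    -- The sequences of `ι a` and `ι b` are constant, so being closer than their own distance is
    -- absurd.
    ε : ℚ
    ε = ℚ.∣ + a ℚ./ 1 ℚ.- + b ℚ./ 1 ∣

    0<ε : 0ℚ ℚ.< ε
    0<ε = ℚ.≰⇒> λ ε≤0 → a≢b (≡.trans (≡.sym (cancel-identity (+ a ℚ./ 1) (+ b ℚ./ 1)))
      (≡.trans (cong (ℚ._+ + b ℚ./ 1) (ℚ.∣p∣≡0⇒p≡0 _ (ℚ.≤-antisym ε≤0 (ℚ.0≤∣p∣ (+ a ℚ./ 1 ℚ.- + b ℚ./ 1)))))
        (ℚ.+-identityˡ (+ b ℚ./ 1))))

    N : ℕ
    N = proj₁ (eq ε 0<ε)

    close : ∀ i → N ℕ.≤ i → ℚ.∣ seq (re (ι a)) i ℚ.- seq (re (ι b)) i ∣ ℚ.< ε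
    close = proj₂ (eq ε 0<ε)

1/ι : ∀ n .{{_ : ℕ.NonZero n}} → ℚ⇒ℂ (+ 1 ℚ./ n) *ᶜ ι n ≈ᶜ 1ᶜ
1/ι n = ≈ᶜ-pointwise (ℚ⇒ℂ (+ 1 ℚ./ n) *ᶜ ι n) 1ᶜ
  (λ i → real (ι-re n i) (ι-im n i) (*-/ n 1)) (λ i → imaginary (seq (re (ι n)) i) (+ 1 ℚ./ n) (ι-im n i))
  where
    open ℚ-Solver.+-*-Solver

    real : ∀ {x y p r} → x ≡ r → y ≡ 0ℚ → r ℚ.* p ≡ 1ℚ → p ℚ.* x ℚ.+ ℚ.- (0ℚ ℚ.* y) ≡ 1ℚ
    real {p = p} {r} refl refl eq = ≡.trans (solve 2 (λ a b → a :* b :+ :- (con 0ℚ :* con 0ℚ) := b :* a) refl p r) eq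

    imaginary : ∀ x {y} p → y ≡ 0ℚ → p ℚ.* y ℚ.+ 0ℚ ℚ.* x ≡ 0ℚ
    imaginary x p refl = solve 2 (λ a b → a :* con 0ℚ :+ con 0ℚ :* b := con 0ℚ) refl p x

ι-cancelᶜ : ∀ n → ℕ.NonZero n → ∀ z w → ι n *ᶜ z ≈ᶜ ι n *ᶜ w → z ≈ᶜ w
ι-cancelᶜ n n≢0 z w = unit-cancel (ℚ⇒ℂ ((+ 1 ℚ./ n) {{n≢0}})) (ι n) z w (1/ι n {{n≢0}})

-- To be read with p = q - 1, Q = q^m, x and y the numbers of nonzero divisors in degrees m and m -
-- 1, and r and s the corresponding values of ω. It says that the claimed value solves the equation
-- that determines the transform.
rational-solution : ∀ p Q x y r s → (+ p ℚ./ 1) ℚ.* r ≡ + x ℚ./ 1 → (+ p ℚ./ 1) ℚ.* s ≡ + y ℚ./ 1 →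
  ι p *ᶜ ℚ⇒ℂ ((+ Q ℚ./ 1) ℚ.* (r ℚ.- s)) +ᶜ ι Q *ᶜ ι y ≈ᶜ ι Q *ᶜ ι x
rational-solution p Q x y r s pr≡x ps≡y = ≈ᶜ-pointwise (ι p *ᶜ ℚ⇒ℂ t +ᶜ ι Q *ᶜ ι y) (ι Q *ᶜ ι x)
  (λ i → real r s (ι-re p i) (ι-im p i) (ι-re Q i) (ι-im Q i)
    (≡.trans (ι-re x i) (≡.sym pr≡x)) (ι-im x i) (≡.trans (ι-re y i) (≡.sym ps≡y)) (ι-im y i))
  (λ i → imaginary (seq (re (ι p)) i) (seq (re (ι Q)) i) (seq (re (ι x)) i) (seq (re (ι y)) i) t
    (ι-im p i) (ι-im Q i) (ι-im x i) (ι-im y i))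
  where
    open ℚ-Solver.+-*-Solver

    t : ℚ
    t = (+ Q ℚ./ 1) ℚ.* (r ℚ.- s)

    real : ∀ {p p′ P P′ X X′ Y Y′ p₀ P₀} x y → p ≡ p₀ → p′ ≡ 0ℚ → P ≡ P₀ → P′ ≡ 0ℚ →
      X ≡ p₀ ℚ.* x → X′ ≡ 0ℚ → Y ≡ p₀ ℚ.* y → Y′ ≡ 0ℚ →
      (p ℚ.* (P₀ ℚ.* (x ℚ.- y)) ℚ.+ ℚ.- (p′ ℚ.* 0ℚ)) ℚ.+ (P ℚ.* Y ℚ.+ ℚ.- (P′ ℚ.* Y′)) ≡ P ℚ.* X ℚ.+ ℚ.- (P′ ℚ.* X′)
    real {p} {P = P} x y refl refl refl refl refl refl refl refl =
      solve 4 (λ p P x y → (p :* (P :* (x :- y)) :+ :- (con 0ℚ :* con 0ℚ)) :+ (P :* (p :* y) :+ :- (con 0ℚ :* con 0ℚ))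
        := P :* (p :* x) :+ :- (con 0ℚ :* con 0ℚ)) refl p P x y

    imaginary : ∀ {p′ P′ X′ Y′} p P X Y s → p′ ≡ 0ℚ → P′ ≡ 0ℚ → X′ ≡ 0ℚ → Y′ ≡ 0ℚ →
      (p ℚ.* 0ℚ ℚ.+ p′ ℚ.* s) ℚ.+ (P ℚ.* Y′ ℚ.+ P′ ℚ.* Y) ≡ P ℚ.* X′ ℚ.+ P′ ℚ.* X
    imaginary p P X Y s refl refl refl refl =
      solve 5 (λ p P X Y s → (p :* con 0ℚ :+ con 0ℚ :* s) :+ (P :* con 0ℚ :+ con 0ℚ :* Y)
        := P :* con 0ℚ :+ con 0ℚ :* X) refl p P X Y s

-- Numbers of coefficients and equations, including the degree -1.

count-difference : ∀ m n → m ℕ.≤ n → count (+ n ℤ.- + m) ≡ suc (n ℕ.∸ m)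
count-difference m n m≤n = cong count (≡.trans (ℤ.m-n≡m⊖n n m) (ℤ.⊖-≥ m≤n))

-- With C = n - m + 1 equations in degree m, these say that degree m - 1 has m coefficients and C +
-- 1 equations, that m + C = n + 1, and that 2m ≤ n + 1 becomes m ≤ C. They hold uniformly, also for
-- m = 0 and n = -1.
record Sizes (m : ℕ) (n : ℤ) : Set where
  field
    columns    : count (+ m ℤ.- + 1) ≡ m
    rows-upper : count (n ℤ.- (+ m ℤ.- + 1)) ≡ suc (count (n ℤ.- + m))
    total      : m ℕ.+ count (n ℤ.- + m) ≡ count n
    wide       : m ℕ.≤ count (n ℤ.- + m)

sizes : ∀ m n → + (2 ℕ.* m) ℤ.≤ n ℤ.+ + 1 → Sizes m n
-- The bound forces n ≥ -1, and n = -1 leaves only m = 0.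
sizes zero    -[1+ zero ]  _  = record { columns = refl ; rows-upper = refl ; total = refl ; wide = z≤n }
sizes (suc m) -[1+ zero ]  (ℤ.+≤+ ())
sizes m       -[1+ suc _ ] ()
sizes m       (+ n)        (ℤ.+≤+ 2m≤n+1) = record
  { columns    = columns m
  ; rows-upper = ≡.trans (rows-upper m m≤n) (cong suc (≡.sym eq))
  ; total      = ≡.trans (cong (m ℕ.+_) eq) (≡.trans (ℕ.+-suc m (n ℕ.∸ m)) (cong suc (ℕ.m+[n∸m]≡n m≤n)))
  ; wide       = subst (m ℕ.≤_) (≡.sym eq) (ℕ.+-cancelˡ-≤ m m (suc (n ℕ.∸ m)) (begin
      m ℕ.+ m                   ≤⟨ m+m≤1+n ⟩
      suc n                     ≡⟨ cong suc (ℕ.m+[n∸m]≡n m≤n) ⟨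
      suc (m ℕ.+ (n ℕ.∸ m))     ≡⟨ ℕ.+-suc m (n ℕ.∸ m) ⟨
      m ℕ.+ suc (n ℕ.∸ m)       ∎))
  }
  where
    open ℕ.≤-Reasoning

    m+m≤1+n : m ℕ.+ m ℕ.≤ suc n
    m+m≤1+n = subst₂ ℕ._≤_ (cong (m ℕ.+_) (ℕ.+-identityʳ m)) (ℕ.+-comm n 1) 2m≤n+1

    half : ∀ m → m ℕ.+ m ℕ.≤ suc n → m ℕ.≤ n
    half zero    _        = z≤n
    half (suc m) (s≤s le) = ℕ.≤-trans (ℕ.m≤n+m (suc m) m) le

    m≤n : m ℕ.≤ n
    m≤n = half m m+m≤1+n

    eq : count (+ n ℤ.- + m) ≡ suc (n ℕ.∸ m)
    eq = count-difference m n m≤n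

    columns : ∀ m → count (+ m ℤ.- + 1) ≡ m
    columns zero    = refl
    columns (suc m) = refl

    rows-upper : ∀ m → m ℕ.≤ n → count (+ n ℤ.- (+ m ℤ.- + 1)) ≡ suc (suc (n ℕ.∸ m))
    rows-upper zero    _   = cong suc (ℕ.+-comm n 1)
    rows-upper (suc m) m<n = ≡.trans (count-difference m n (ℕ.<⇒≤ m<n)) (cong suc (ℕ.+-∸-assoc 1 m<n))

-- Application to the given field and character.

module Main {c : Level} (k : FiniteField c) (ψ₀ : FiniteField.AdditiveCharacter k)
  (nontrivial : FiniteField.AdditiveCharacter.Nontrivial ψ₀) where
  open FiniteField k
  open AdditiveCharacter ψ₀
  open Hankel k
  open Divisibility k
  open Characteristic k
  open CommutativeRing commutativeRing using (+-identityˡ)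

  -- By `homo` the number ψ 0 equals its own square, and being on the unit circle it is invertible,
  -- with its conjugate as inverse.
  ψ-0 : ψ 0# ≈ᶜ 1ᶜ
  ψ-0 = idempotent-unit (conj (ψ 0#)) (ψ 0#) (conj-unit (ψ 0#) (onUnitCircle 0#))
    (subst (λ a → ψ a ≈ᶜ ψ 0# *ᶜ ψ 0#) (+-identityˡ 0#) (homo 0# 0#))

  ψe-fixed⇒0 : ∀ z → ψ (proj₁ nontrivial) *ᶜ z ≈ᶜ z → z ≈ᶜ 0ᶜ
  ψe-fixed⇒0 z = fixed⇒0 (ψ (proj₁ nontrivial)) z (proj₂ nontrivial)

  open Transform.WithCharacter k ℂ-commutativeRing ψ homo ψ-0 (proj₁ nontrivial) ψe-fixed⇒0 ι-injectiveᶜ ι-cancelᶜ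
    using (transform)

  divisors : ∀ d n → V k n → ℕ
  divisors d n P = List.length (List.filter (nonzeroDivisor? k d n P) (vectors k (count d)))

  ω-scaled : ∀ d n P → (+ (q ℕ.∸ 1) ℚ./ 1) ℚ.* ω k d n P ≡ + divisors d n P ℚ./ 1
  ω-scaled d n P = *-/ (q ℕ.∸ 1) (divisors d n P) {{q-1-nonZero}}

  -- The degree m - 1 is kept as a variable `d₀`, so that `count d₀ ≡ m` can be matched with `refl`;
  -- for the difference itself the count reduces only after a case distinction on m.
  fourier-χ-H : ∀ m n (P : V k n) → Sizes m n →
    ∀ d₀ → count d₀ ≡ m → count (n ℤ.- d₀) ≡ suc (count (n ℤ.- + m)) →
    fourier k ψ₀ n (χ-H k m n) P ≈ᶜ ℚ⇒ℂ ((+ (q ℕ.^ m) ℚ./ 1) ℚ.* (ω k (+ m) n P ℚ.- ω k d₀ n P))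
  fourier-χ-H m n P sz d₀ refl C₀ =
    transform m C (Sizes.wide sz) (H? k m n) (H⇒kernel m n) (kernel⇒H m n) (Sizes.total sz) P
      (nonzeroDivisor? k (+ m) n P) (λ _ → proj₁)
      (λ Q (Q≢0 , div) → divides⇒factors (+ m) n Q P Q≢0 div)
      (λ Q Q≢0 fac → Q≢0 , factors⇒divides (+ m) n Q P Q≢0 fac)
      (nonzeroDivisor? k d₀ n P) (λ _ → proj₁)
      (λ Q (Q≢0 , div) → subst (λ C → Factors (count n) C P Q) C₀ (divides⇒factors d₀ n Q P Q≢0 div))
      (λ Q Q≢0 fac → Q≢0 , factors⇒divides d₀ n Q P Q≢0 (subst (λ C → Factors (count n) C P Q) (≡.sym C₀) fac))
      (χ-H k m n) (λ _ → refl) (⟨_,_⟩ k {n} P) (bracket≡dot P) q-1-nonZero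
      (ℚ⇒ℂ ((+ (q ℕ.^ m) ℚ./ 1) ℚ.* (ω k (+ m) n P ℚ.- ω k d₀ n P)))
      (rational-solution (q ℕ.∸ 1) (q ℕ.^ m) (divisors (+ m) n P) (divisors d₀ n P) (ω k (+ m) n P) (ω k d₀ n P)
        (ω-scaled (+ m) n P) (ω-scaled d₀ n P))
    where
      C : ℕ
      C = count (n ℤ.- + m)

open import Data.Nat.Base using (ℕ; _*_; _^_)
open import Data.Integer.Base using (ℤ; +_; 1ℤ; _≤_) renaming (_+_ to _+ℤ_; _-_ to _-ℤ_)
open import Data.Rational.Base using (_/_) renaming (_*_ to _*ℚ_; _-_ to _-ℚ_)
open FiniteField using (q; AdditiveCharacter)

theorem1 : ∀ {c} (k : FiniteField c) (ψ₀ : AdditiveCharacter k) → AdditiveCharacter.Nontrivial ψ₀ →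
    (m : ℕ) (n : ℤ) → + (2 * m) ≤ n +ℤ 1ℤ → (P : V k n) →
    fourier k ψ₀ n (χ-H k m n) P
    ≈ᶜ ℚ⇒ℂ ((+ (q k ^ m) / 1) *ℚ (ω k (+ m) n P -ℚ ω k (+ m -ℤ 1ℤ) n P))
theorem1 k ψ₀ nontrivial m n 2m≤n+1 P =
  Main.fourier-χ-H k ψ₀ nontrivial m n P sz (+ m -ℤ 1ℤ) (Sizes.columns sz) (Sizes.rows-upper sz)
  where
    sz : Sizes m n
    sz = sizes m n 2m≤n+1
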